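{- For every real $\beta$ with $0<\beta\le \frac{5}{14}$, the asymptotic competitive search ratio satisfies $\hat S(\beta)\le 3$.
   Context: Model. $n$ robots with distinct identities start at time $0$ at the origin of the real line and move along the line with speed at most $1$, changing direction or speed at no cost. A target lies at an unknown point at distance $d>0$ from the origin, i.e. at $d$ or $-d$, with $d$ unknown to the robots. At most $f$ robots are faulty; the bound $f$ is known, but not which robots are faulty. A search algorithm assigns each robot a trajectory, known to all robots; a robot's further motion may depend on the messages broadcast so far (computation and communication take no time). A robot detects whether the target is at a point only by being there. The only messages are announcements "the target is here", heard instantly by all robots at any distance; each message automatically carries the true identity and true current location of its sender. A robot visiting a point silently is taken to claim that the target is not there. Reliable (non-faulty) robots follow the algorithm and report truthfully. Faulty robots are controlled by an adversary: they may stay silent at the target or announce the target where it is not; a faulty robot that broadcasts while off its assigned trajectory is thereby detected as faulty. The search is completed at the first time when some reliable robot has visited the target and announced it and all reliable robots can be certain of its location (every scenario with at most $f$ faulty robots consistent with the messages so far has the target at that location). For an algorithm, the search time $S_d(n,f)$ is the worst-case completion time over both positions $\pm d$ of the target, all choices of at most $f$ faulty robots, and all behaviours of the faulty robots. The inequality $S_d(n,f)\le cd$ means that there is an algorithm, not depending on $d$, with search time at most $cd$ for every $d>0$. Asymptotic ratio. For non-integer $n$, $S_d(n,f)$ means $S_d(\lceil n\rceil,f)$ ($f$ is always an integer). For a density $\beta=f/n>0$ of faulty robots, $$\hat S(\beta)=\min\{\alpha \mid \exists \text{ a constant } c_\beta \text{ such that for all integers } f>0,\ S_d(f/\beta+c_\beta,f)\le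 \alpha d\}.$$ -}

module Defs where

open import Algebra.Core using (Op₁; Op₂)
open import Algebra.Bundles using (RawMonoid)
open import Algebra.Structures using (IsCommutativeRing)
open import Data.Bool.Base using (Bool; true; if_then_else_)
open import Data.Fin.Base using (Fin)
open import Data.Fin.Subset using (Subset; _∉_; ∣_∣)
open import Data.Maybe.Base using (Maybe; just; nothing)
open import Data.Nat.Base as ℕ using (ℕ)
open import Data.Product.Base using (∃; ∃-syntax; Σ-syntax; _×_)
open import Data.Sum.Base using (_⊎_)
open import Function.Bundles using (_⇔_)
open import Level using (0ℓ)
open import Relation.Binary.Core using (Rel)
open import Relation.Binary.Structures using (IsTotalOrder)
open import Relation.Binary.PropositionalEquality.Core using (_≡_; _≢_)
import Algebra.Definitions.RawMonoid as Multiples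
import Relation.Binary.Construct.NonStrictToStrict as ToStrict

-- Classically, ℝ is the unique instance up to isomorphism.
record CompleteOrderedField : Set₁ where
  infix  4 _≤_
  infixl 6 _+_ _-_
  infixl 7 _*_ _/_
  infix  8 -_
  infix  9 _⁻¹

  field
    Carrier : Set
    _+_ _*_ : Op₂ Carrier
    -_ _⁻¹  : Op₁ Carrier
    0# 1#   : Carrier
    _≤_     : Rel Carrier 0ℓ

    isCommutativeRing : IsCommutativeRing _≡_ _+_ _*_ -_ 0# 1#
    0#≢1#             : 0# ≢ 1#
    -- 0# ⁻¹ is left unspecified.
    *-inverseʳ        : ∀ x → x ≢ 0# → x * x ⁻¹ ≡ 1#

    isTotalOrder : IsTotalOrder _≡_ _≤_
    +-monoˡ-≤    : ∀ z {x y} → x ≤ y → x + z ≤ y + z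
    *-nonNeg     : ∀ {x y} → 0# ≤ x → 0# ≤ y → 0# ≤ x * y

  UpperBound : (Carrier → Set) → Carrier → Set
  UpperBound P b = ∀ x → P x → x ≤ b

  IsSupremum : (Carrier → Set) → Carrier → Set
  IsSupremum P s = UpperBound P s × (∀ b → UpperBound P b → s ≤ b)

  field
    complete : (P : Carrier → Set) → ∃ P → ∃ (UpperBound P) → ∃ (IsSupremum P)

  open ToStrict _≡_ _≤_ public using (_<_)

  _-_ _/_ : Op₂ Carrier
  x - y = x + (- y)
  x / y = x * y ⁻¹

  +-rawMonoid : RawMonoid 0ℓ 0ℓ
  +-rawMonoid = record { Carrier = Carrier ; _≈_ = _≡_ ; _∙_ = _+_ ; ε = 0# }

  fromℕ : ℕ → Carrier
  fromℕ n = Multiples._×_ +-rawMonoid n 1#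

  IsCeiling : Carrier → ℕ → Set
  IsCeiling x n = x ≤ fromℕ n × fromℕ n < x + 1#

module Search (ℝ : CompleteOrderedField) where
  open CompleteOrderedField ℝ

  -- Reals serve both as positions and as times.  Time starts at 0#; values at
  -- negative times are irrelevant everywhere below.
  record Trajectory : Set where
    field
      at     : Carrier → Carrier
      origin : at 0# ≡ 0#
      -- | at t - at s | ≤ t - s
      speed  : ∀ {s t} → 0# ≤ s → s ≤ t →
               at t - at s ≤ t - s × at s - at t ≤ t - s

  open Trajectory public

  -- H i t ≡ just x : at time t robot i, located at x, announces
  -- "the target is here".
  Transcript : ℕ → Set
  Transcript n = Fin n → Carrier → Maybe Carrier

  AgreeBefore AgreeUpTo : ∀ {n} → Carrier → Transcript n → Transcript n → Set
  AgreeBefore t H H′ = ∀ j s → 0# ≤ s → s < t → H j s ≡ H′ j s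
  AgreeUpTo   t H H′ = ∀ j s → 0# ≤ s → s ≤ t → H j s ≡ H′ j s

  -- A message heard at time t can only influence positions after time t.
  record Algorithm (n : ℕ) : Set where
    field
      assign : Transcript n → Fin n → Trajectory
      causal : ∀ H H′ i {t} → 0# ≤ t → AgreeBefore t H H′ →
               at (assign H i) t ≡ at (assign H′ i) t

  open Algorithm public

  FirstVisit : Trajectory → Carrier → Carrier → Set
  FirstVisit p x t = at p t ≡ x × (∀ s → 0# ≤ s → s < t → at p s ≢ x)

  -- A complete run of the algorithm.  A reliable robot announces the target
  -- exactly once, on its first visit: later repetitions would carry no
  -- information, and every choice of target, faulty set and behaviour of the
  -- faulty robots then extends to a run.  (With announcements at every visit, an
  -- algorithm could make a robot leave the target iff it is heard staying there,
  -- and so have no runs at all.)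
  record Scenario {n : ℕ} (A : Algorithm n) (f : ℕ) : Set where
    field
      target    : Carrier
      target≢0  : target ≢ 0#
      faulty    : Subset n
      atMost    : ∣ faulty ∣ ℕ.≤ f
      path      : Fin n → Trajectory
      announces : Fin n → Carrier → Bool

    -- The attached location is the true one, for faulty robots too.
    transcript : Transcript n
    transcript i t = if announces i t then just (at (path i) t) else nothing

    field
      obedient : ∀ {i} → i ∉ faulty → ∀ {t} → 0# ≤ t →
                 at (path i) t ≡ at (assign A transcript i) t
      truthful : ∀ {i} → i ∉ faulty → ∀ {t} → 0# ≤ t →
                 announces i t ≡ true ⇔ FirstVisit (path i) target t

  module _ {n f : ℕ} {A : Algorithm n} where
    open Scenario

    Found : Scenario A f → Carrier → Set
    Found E T = ∃[ i ] i ∉ faulty E ×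
      (∃[ t ] 0# ≤ t × t ≤ T × transcript E i t ≡ just (target E))

    Certain : Scenario A f → Carrier → Set
    Certain E T = (E′ : Scenario A f) →
      AgreeUpTo T (transcript E) (transcript E′) → target E′ ≡ target E

    CompletedAt : Scenario A f → Carrier → Set
    CompletedAt E T = Found E T × Certain E T

  -- S_d(n,f) ≤ α d for every d > 0, with an algorithm independent of d.
  SearchRatio≤ : ℕ → ℕ → Carrier → Set
  SearchRatio≤ n f α = Σ[ A ∈ Algorithm n ]
    (∀ d → 0# < d → (E : Scenario A f) →
      Scenario.target E ≡ d ⊎ Scenario.target E ≡ - d →
      ∃[ T ] 0# ≤ T × T ≤ α * d × CompletedAt E T)

  AsymptoticRatio : Carrier → Carrier → Set
  AsymptoticRatio β α = ∃[ c ] (∀ f → 0 ℕ.< f →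
    ∃[ n ] IsCeiling (fromℕ f / β + c) n × SearchRatio≤ n f α)

  -- Ŝ(β) is the minimum of the set AsymptoticRatio β.
  Ŝ[_]≤_ : Carrier → Carrier → Set
  Ŝ[ β ]≤ a = ∃[ α ] AsymptoticRatio β α × α ≤ a

{-# OPTIONS --safe #-}
module Submission where

open import Defs
open import Axiom.ExcludedMiddle using (ExcludedMiddle)
open import Algebra.Bundles using (CommutativeRing)
import Algebra.Properties.AbelianGroup as AbelianGroupProperties
import Algebra.Properties.Ring as RingProperties
import Algebra.Properties.Semiring.Mult as Mult
import Algebra.Solver.Ring as RingSolver
open import Algebra.Solver.Ring.AlmostCommutativeRing
  using (AlmostCommutativeRing; fromCommutativeRing; _-Raw-AlmostCommutative⟶_)
open import Data.Bool.Base using (Bool; true; false)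
open import Data.Fin.Base using (Fin; zero; suc)
open import Data.Fin.Subset
  using (Subset; ⊥; _∈_; _∉_; _⊆_; _∪_; _∩_; ∁; Nonempty; ∣_∣; inside; outside)
open import Data.Fin.Subset.Properties
  using ( _∈?_; nonempty?; Empty-unique; ∣⊤∣≡n; ∣⊥∣≡0; ∣p∩q∣≤∣q∣; p⊆q⇒∣p∣≤∣q∣
        ; p∩q⊆p; p∩q⊆q; x∈p∩q⁺; x∈p∩q⁻; x∈p∪q⁺; x∈p∪q⁻; x∈∁p⇒x∉p )
open import Data.Integer.Base as ℤ using (ℤ; -[1+_]; +[1+_])
import Data.Integer.Properties as ℤ
open import Data.Maybe.Base using (Maybe; just; nothing)
open import Data.Nat.Base as ℕ using (ℕ; zero; suc)
import Data.Nat.DivMod as ℕ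
import Data.Nat.Properties as ℕ
open import Data.Nat.Solver using (module +-*-Solver)
open import Data.Product.Base using (∃; ∃-syntax; _×_; _,_; proj₁; proj₂)
open import Data.Sum.Base using (_⊎_; inj₁; inj₂; [_,_]′)
open import Data.Vec.Base using (Vec; []; _∷_; map; replicate; _++_; concat; lookup)
open import Data.Vec.Properties using (map-++; map-replicate; lookup-map; []=⇒lookup)
open import Function.Base using (_∘_; case_of_)
open import Function.Bundles using (Equivalence)
open import Level using (0ℓ)
open import Relation.Nullary.Decidable.Core using (Dec; yes; no)
open import Relation.Nullary.Negation.Core using (¬_; contradiction)
open import Relation.Binary.PropositionalEquality
open import Relation.Binary.Structures using (IsTotalOrder)
import Relation.Binary.Construct.NonStrictToStrict as ToStrict

-- Take 14k robots with f < 5k, half of them marching each way at speed 1.  Each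
-- half consists of 4k leads, k follows and 2k returns.  When 2k robots of one half
-- announce the target together, the follows and returns of the other half turn
-- round to vote there; when afterwards k leads of that other half announce
-- together, its returns turn round once more.
-- If two targets x and x′ explain the same messages with faulty sets F and F′, then
-- every robot that has visited x or x′ lies in F ∪ F′, and every robot that has
-- announced a third place lies in F ∩ F′.  In each case the visits made and the
-- announcements that triggered the turns give |F| + |F′| ≥ 10k > 2f by time 3d.

-- The time budget: a robot that turns at time t reaches the point at distance d on the other side
-- at time d + 2t, and one that turns at t and again at u reaches the point at distance d on its own
-- side at time d + 2(u - t). Both are at most 3d as soon as the turns happen by time d, so each
-- trigger must be one that the adversary cannot delay beyond d. This dictates the thresholds. Of
-- the 7k robots marching to the target at most 5k are faulty, which leaves 2k for the first
-- announcement. If that announcement was false, its 2k authors are faulty, so fewer than 3k of the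
-- 4k leads on the other side are, which leaves k for the second. A robot sent across is lost to its
-- own side if the announcement was false; a robot called back is lost to the other side if the
-- second one was false. Hence three ranks. In units of k the counts are 7 + 3 (nobody called back),
-- 7 + 1 + 2·1 (false call back), 4 + 2 + 2·2 (false first announcement), where the doubled terms
-- are robots lying under both hypotheses. All three equal 10, so the split 4 : 1 : 2 has no slack.
-- If a trigger names the rival target itself, the count is 7 + 4.

-- Arithmetic and order in a complete ordered field

module OrderedField (ℝ : CompleteOrderedField) where
  open CompleteOrderedField ℝ public

  commutativeRing : CommutativeRing 0ℓ 0ℓ
  commutativeRing = record { isCommutativeRing = isCommutativeRing }

  open CommutativeRing commutativeRing public
    using ( +-assoc; +-comm; +-identityˡ; +-identityʳ; -‿inverseʳ; -‿inverseˡ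
          ; *-assoc; *-comm; *-identityʳ; zeroʳ; semiring; ring; +-abelianGroup )
  open AbelianGroupProperties +-abelianGroup public
    using () renaming (⁻¹-involutive to -‿involutive; ⁻¹-∙-comm to -‿+-comm;
                       ε⁻¹≈ε to -0#≡0#)
  open RingProperties ring public using (-‿distribˡ-*; -‿distribʳ-*)

  fromℕ-+ : ∀ m n → fromℕ (m ℕ.+ n) ≡ fromℕ m + fromℕ n
  fromℕ-+ = Mult.×-homo-+ semiring 1#

  fromℕ-* : ∀ m n → fromℕ (m ℕ.* n) ≡ fromℕ m * fromℕ n
  fromℕ-* = Mult.×1-homo-* semiring

  -- Over integer coefficients the ring solver recognises that x - x vanishes; over
  -- the field itself it has no computing zero test.
  fromℤ : ℤ → Carrier
  fromℤ (ℤ.+ n)    = fromℕ n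
  fromℤ -[1+ n ]   = - fromℕ (suc n)

  fromℤ-⊖ : ∀ m n → fromℤ (m ℤ.⊖ n) ≡ fromℕ m - fromℕ n
  fromℤ-⊖ m       zero    = sym (trans (cong (fromℕ m +_) -0#≡0#) (+-identityʳ _))
  fromℤ-⊖ zero    (suc n) = sym (+-identityˡ _)
  fromℤ-⊖ (suc m) (suc n) = begin
    fromℤ (suc m ℤ.⊖ suc n)                 ≡⟨ cong fromℤ (ℤ.[1+m]⊖[1+n]≡m⊖n m n) ⟩
    fromℤ (m ℤ.⊖ n)                         ≡⟨ fromℤ-⊖ m n ⟩
    fromℕ m - fromℕ n                       ≡⟨ cong (_- fromℕ n) (sym (+-identityˡ _)) ⟩
    0# + fromℕ m - fromℕ n                  ≡⟨ cong (λ z → z + fromℕ m - fromℕ n) (sym (-‿inverseˡ 1#)) ⟩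
    - 1# + 1# + fromℕ m - fromℕ n           ≡⟨ cong (_- fromℕ n) (trans (+-assoc _ _ _) (+-comm _ _)) ⟩
    fromℕ (suc m) - 1# - fromℕ n            ≡⟨ +-assoc _ _ _ ⟩
    fromℕ (suc m) + (- 1# - fromℕ n)        ≡⟨ cong (fromℕ (suc m) +_) (-‿+-comm 1# (fromℕ n)) ⟩
    fromℕ (suc m) - fromℕ (suc n)           ∎
    where open ≡-Reasoning

  fromℤ-+ : ∀ i j → fromℤ (i ℤ.+ j) ≡ fromℤ i + fromℤ j
  fromℤ-+ (ℤ.+ m)  (ℤ.+ n)  = fromℕ-+ m n
  fromℤ-+ (ℤ.+ m)  -[1+ n ] = fromℤ-⊖ m (suc n)
  fromℤ-+ -[1+ m ] (ℤ.+ n)  = trans (fromℤ-⊖ n (suc m)) (+-comm _ _)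
  fromℤ-+ -[1+ m ] -[1+ n ] = begin
    - fromℕ (suc (suc (m ℕ.+ n)))     ≡⟨ cong (λ k → - fromℕ k) (sym (ℕ.+-suc (suc m) n)) ⟩
    - fromℕ (suc m ℕ.+ suc n)         ≡⟨ cong -_ (fromℕ-+ (suc m) (suc n)) ⟩
    - (fromℕ (suc m) + fromℕ (suc n)) ≡⟨ sym (-‿+-comm _ _) ⟩
    - fromℕ (suc m) - fromℕ (suc n)   ∎
    where open ≡-Reasoning

  fromℤ-neg : ∀ i → fromℤ (ℤ.- i) ≡ - fromℤ i
  fromℤ-neg (ℤ.+ zero) = sym -0#≡0#
  fromℤ-neg +[1+ n ]   = refl
  fromℤ-neg -[1+ n ]   = sym (-‿involutive _)

  fromℤ-*⁺ : ∀ m j → fromℤ (ℤ.+ m ℤ.* j) ≡ fromℕ m * fromℤ j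
  fromℤ-*⁺ m (ℤ.+ n)  = trans (cong fromℤ (sym (ℤ.pos-* m n))) (fromℕ-* m n)
  fromℤ-*⁺ m -[1+ n ] = begin
    fromℤ (ℤ.+ m ℤ.* -[1+ n ])        ≡⟨ cong fromℤ (sym (ℤ.neg-distribʳ-* (ℤ.+ m) +[1+ n ])) ⟩
    fromℤ (ℤ.- (ℤ.+ m ℤ.* +[1+ n ]))  ≡⟨ fromℤ-neg (ℤ.+ m ℤ.* +[1+ n ]) ⟩
    - fromℤ (ℤ.+ m ℤ.* +[1+ n ])      ≡⟨ cong -_ (fromℤ-*⁺ m +[1+ n ]) ⟩
    - (fromℕ m * fromℕ (suc n))       ≡⟨ -‿distribʳ-* _ _ ⟩
    fromℕ m * - fromℕ (suc n)         ∎
    where open ≡-Reasoning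

  fromℤ-* : ∀ i j → fromℤ (i ℤ.* j) ≡ fromℤ i * fromℤ j
  fromℤ-* (ℤ.+ m)  j = fromℤ-*⁺ m j
  fromℤ-* -[1+ m ] j = begin
    fromℤ (-[1+ m ] ℤ.* j)            ≡⟨ cong fromℤ (sym (ℤ.neg-distribˡ-* +[1+ m ] j)) ⟩
    fromℤ (ℤ.- (+[1+ m ] ℤ.* j))      ≡⟨ fromℤ-neg (+[1+ m ] ℤ.* j) ⟩
    - fromℤ (+[1+ m ] ℤ.* j)          ≡⟨ cong -_ (fromℤ-*⁺ (suc m) j) ⟩
    - (fromℕ (suc m) * fromℤ j)       ≡⟨ -‿distribˡ-* _ _ ⟩
    - fromℕ (suc m) * fromℤ j         ∎
    where open ≡-Reasoning

  almostCommutativeRing : AlmostCommutativeRing 0ℓ 0ℓ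
  almostCommutativeRing = fromCommutativeRing commutativeRing

  fromℤ-morphism : ℤ.+-*-rawRing -Raw-AlmostCommutative⟶ almostCommutativeRing
  fromℤ-morphism = record
    { ⟦_⟧    = fromℤ
    ; +-homo = fromℤ-+
    ; *-homo = fromℤ-*
    ; -‿homo = fromℤ-neg
    ; 0-homo = refl
    ; 1-homo = +-identityʳ 1#
    }

  fromℤ-≟ : (i j : ℤ) → Maybe (fromℤ i ≡ fromℤ j)
  fromℤ-≟ i j with i ℤ.≟ j
  ... | yes i≡j = just (cong fromℤ i≡j)
  ... | no  _   = nothing

  module Solver = RingSolver ℤ.+-*-rawRing almostCommutativeRing fromℤ-morphism fromℤ-≟
  open Solver using (solve; _:+_; _:-_; :-_; _:=_; _:*_; con)

  open IsTotalOrder isTotalOrder public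
    using (antisym; total) renaming (refl to ≤-refl; reflexive to ≤-reflexive; trans to ≤-trans)

  <⇒≤ : ∀ {x y} → x < y → x ≤ y
  <⇒≤ = proj₁

  <⇒≱ : ∀ {x y} → x < y → ¬ (y ≤ x)
  <⇒≱ = ToStrict.<⇒≱ _≡_ _≤_ antisym

  ≰⇒> : ∀ {x y} → ¬ (x ≤ y) → y < x
  ≰⇒> = ToStrict.≰⇒> _≡_ _≤_ sym ≤-reflexive total

  <-≤-trans : ∀ {x y z} → x < y → y ≤ z → x < z
  <-≤-trans = ToStrict.<-≤-trans _≡_ _≤_ sym ≤-trans antisym (λ { refl x≤y → x≤y })

  ≤-<-trans : ∀ {x y z} → x ≤ y → y < z → x < z
  ≤-<-trans = ToStrict.≤-<-trans _≡_ _≤_ ≤-trans antisym (λ { refl x≤y → x≤y })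

  ≤⇒0≤- : ∀ {x y} → x ≤ y → 0# ≤ y - x
  ≤⇒0≤- {x} {y} x≤y = subst (_≤ y - x) (-‿inverseʳ x) (+-monoˡ-≤ (- x) x≤y)

  0≤-⇒≤ : ∀ {x y} → 0# ≤ y - x → x ≤ y
  0≤-⇒≤ {x} {y} 0≤y-x = subst₂ _≤_ (+-identityˡ x)
    (solve 2 (λ x y → y :- x :+ x := y) refl x y) (+-monoˡ-≤ x 0≤y-x)

  +-mono-≤ : ∀ {w x y z} → w ≤ x → y ≤ z → w + y ≤ x + z
  +-mono-≤ {w} {x} {y} {z} w≤x y≤z = ≤-trans (+-monoˡ-≤ y w≤x)
    (subst₂ _≤_ (+-comm y x) (+-comm z x) (+-monoˡ-≤ x y≤z))

  +-nonNeg : ∀ {x y} → 0# ≤ x → 0# ≤ y → 0# ≤ x + y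
  +-nonNeg {x} {y} 0≤x 0≤y = subst (_≤ x + y) (+-identityˡ 0#) (+-mono-≤ 0≤x 0≤y)

  shift-≤ : ∀ {a b x y} → a ≤ b → y - x ≡ b - a → x ≤ y
  shift-≤ a≤b eq = 0≤-⇒≤ (subst (0# ≤_) (sym eq) (≤⇒0≤- a≤b))

  shift-≤₂ : ∀ {a b c d x y} → a ≤ b → c ≤ d → y - x ≡ (b - a) + (d - c) → x ≤ y
  shift-≤₂ a≤b c≤d eq =
    0≤-⇒≤ (subst (0# ≤_) (sym eq) (+-nonNeg (≤⇒0≤- a≤b) (≤⇒0≤- c≤d)))

-- The two half-lines, trajectories with reversals, and earliest times

data Side : Set where
  left right : Side

opposite : Side → Side
opposite left  = right
opposite right = left

same-or-opposite : ∀ ξ ρ → ξ ≡ opposite ρ ⊎ ξ ≡ ρ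
same-or-opposite left  left  = inj₂ refl
same-or-opposite left  right = inj₁ refl
same-or-opposite right left  = inj₁ refl
same-or-opposite right right = inj₂ refl

opposite-≢ : ∀ ρ → ρ ≢ opposite ρ
opposite-≢ left  ()
opposite-≢ right ()

module Motion (em : ExcludedMiddle 0ℓ) (ℝ : CompleteOrderedField) where
  open OrderedField ℝ public
  open Search ℝ public
  open Solver using (solve; _:+_; _:-_; :-_; _:=_; _:*_; con)

  decide : ∀ (P : Set) → Dec P
  decide _ = em

  _≤?_ : ∀ x y → Dec (x ≤ y)
  x ≤? y = em

  ≮⇒≥ : ∀ {x y} → ¬ (x < y) → y ≤ x
  ≮⇒≥ {x} {y} x≮y with y ≤? x
  ... | yes y≤x = y≤x
  ... | no  y≰x = contradiction (≰⇒> y≰x) x≮y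

  signed : Side → Carrier → Carrier
  signed right x = x
  signed left  x = - x

  signed-injective : ∀ ρ {x y} → signed ρ x ≡ signed ρ y → x ≡ y
  signed-injective right eq = eq
  signed-injective left {x} {y} eq =
    trans (sym (-‿involutive x)) (trans (cong -_ eq) (-‿involutive y))

  signed-cancel : ∀ ρ {x y} → signed ρ x ≡ signed (opposite ρ) y → x + y ≡ 0#
  signed-cancel right {x} {y} x≡-y = trans (cong (_+ y) x≡-y) (-‿inverseˡ y)
  signed-cancel left  {x} {y} -x≡y = trans (cong (x +_) (sym -x≡y)) (-‿inverseʳ x)

  signed-≢ʳ : ∀ ρ {x y} → 0# < x → 0# ≤ y → signed ρ x ≢ signed (opposite ρ) y
  signed-≢ʳ ρ {x} 0<x 0≤y eq = <⇒≱ 0<x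
    (subst₂ _≤_ (+-identityʳ x) (signed-cancel ρ eq) (+-mono-≤ ≤-refl 0≤y))

  signed-≢ˡ : ∀ ρ {x y} → 0# < x → 0# ≤ y → signed ρ y ≢ signed (opposite ρ) x
  signed-≢ˡ ρ {x} 0<x 0≤y eq = <⇒≱ 0<x
    (subst₂ _≤_ (+-identityˡ x) (signed-cancel ρ eq) (+-mono-≤ 0≤y ≤-refl))

  march : Side → Trajectory
  march ρ = record { at = signed ρ ; origin = origin-signed ρ ; speed = speed-signed ρ }
    where
    origin-signed : ∀ ρ → signed ρ 0# ≡ 0#
    origin-signed left  = -0#≡0#
    origin-signed right = refl
    backward : ∀ {s t} → s ≤ t → s - t ≤ t - s
    backward {s} {t} s≤t = shift-≤₂ s≤t s≤t
      (solve 2 (λ s t → t :- s :- (s :- t) := (t :- s) :+ (t :- s)) refl s t)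
    speed-signed : ∀ ρ {s t} → 0# ≤ s → s ≤ t →
      signed ρ t - signed ρ s ≤ t - s × signed ρ s - signed ρ t ≤ t - s
    speed-signed right         _ s≤t = ≤-refl , backward s≤t
    speed-signed left  {s} {t} _ s≤t =
      subst (_≤ t - s) (solve 2 (λ s t → s :- t := :- t :- (:- s)) refl s t) (backward s≤t) ,
      ≤-reflexive (solve 2 (λ s t → :- s :- (:- t) := t :- s) refl s t)

  rest : Trajectory
  rest = record { at = λ _ → 0# ; origin = refl ; speed = λ _ s≤t → still s≤t , still s≤t }
    where
    still : ∀ {s t} → s ≤ t → 0# - 0# ≤ t - s
    still {s} {t} s≤t = subst (_≤ t - s) (sym (-‿inverseʳ 0#)) (≤⇒0≤- s≤t)

  module _ (u : Carrier) (p : Trajectory) where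

    -- Reversing the velocity at time u reflects the rest of the path in at p u.
    reverse-at : Carrier → Carrier
    reverse-at t with t ≤? u
    ... | yes _ = at p t
    ... | no  _ = at p u + at p u - at p t

    reverse-before : ∀ {t} → t ≤ u → reverse-at t ≡ at p t
    reverse-before {t} t≤u with t ≤? u
    ... | yes _   = refl
    ... | no  t≰u = contradiction t≤u t≰u

    reverse-after : ∀ {t} → u ≤ t → reverse-at t ≡ at p u + at p u - at p t
    reverse-after {t} u≤t with t ≤? u
    ... | no  _   = refl
    ... | yes t≤u with antisym u≤t t≤u
    ...   | refl = sym (solve 1 (λ x → x :+ x :- x := x) refl (at p u))

    reverse-speed : 0# ≤ u → ∀ {s t} → 0# ≤ s → s ≤ t →
      reverse-at t - reverse-at s ≤ t - s × reverse-at s - reverse-at t ≤ t - s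
    reverse-speed 0≤u {s} {t} 0≤s s≤t with s ≤? u | t ≤? u
    ... | yes _   | yes _   = speed p 0≤s s≤t
    ... | no  s≰u | yes t≤u = contradiction (≤-trans s≤t t≤u) s≰u
    ... | no  _   | no  _   =
      subst (_≤ t - s) (solve 3 (λ a b c → a :- b := c :+ c :- b :- (c :+ c :- a)) refl ps pt pu) down ,
      subst (_≤ t - s) (solve 3 (λ a b c → b :- a := c :+ c :- a :- (c :+ c :- b)) refl ps pt pu) up
      where
      ps = at p s
      pt = at p t
      pu = at p u
      up : pt - ps ≤ t - s
      up = proj₁ (speed p 0≤s s≤t)
      down : ps - pt ≤ t - s
      down = proj₂ (speed p 0≤s s≤t)
    -- The interval is cut at `u`: the displacement is the one up to `u` minus the one that `p`
    -- makes after `u`, and each part obeys its own speed bound.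
    ... | yes s≤u | no  t≰u =
      shift-≤₂ (proj₁ su) (proj₂ ut) (solve 6 (λ s t u a b c →
        t :- s :- (c :+ c :- b :- a) := (u :- s :- (c :- a)) :+ (t :- u :- (c :- b))) refl s t u ps pt pu) ,
      shift-≤₂ (proj₂ su) (proj₁ ut) (solve 6 (λ s t u a b c →
        t :- s :- (a :- (c :+ c :- b)) := (u :- s :- (a :- c)) :+ (t :- u :- (b :- c))) refl s t u ps pt pu)
      where
      ps = at p s
      pt = at p t
      pu = at p u
      su = speed p 0≤s s≤u
      ut = speed p 0≤u (<⇒≤ (≰⇒> t≰u))

    reverse : 0# ≤ u → Trajectory
    reverse 0≤u = record
      { at     = reverse-at
      ; origin = trans (reverse-before 0≤u) (origin p)
      ; speed  = reverse-speed 0≤u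
      }

  Earliest : (Carrier → Set) → Carrier → Set
  Earliest P t = 0# ≤ t × P t × (∀ s → 0# ≤ s → P s → t ≤ s)

  Earliest-unique : ∀ {P s t} → Earliest P s → Earliest P t → s ≡ t
  Earliest-unique (0≤s , Ps , s≤) (0≤t , Pt , t≤) = antisym (s≤ _ 0≤t Pt) (t≤ _ 0≤s Ps)

  -- A condition on real times may hold without holding at an earliest time. The path is then left
  -- unchanged, which keeps the operation total; for the triggers of the strategy, `Earliest-Quorum`
  -- excludes this case.
  reverseWhen : (Carrier → Set) → Trajectory → Trajectory
  reverseWhen P p with decide (∃ (Earliest P))
  ... | yes (t , 0≤t , _) = reverse t p 0≤t
  ... | no  _             = p

  at-reverseWhen : ∀ {P p t} (earliest : Earliest P t) →
    ∀ s → at (reverseWhen P p) s ≡ reverse-at t p s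
  at-reverseWhen {P} {p} earliest s with decide (∃ (Earliest P))
  ... | no  none              = contradiction (_ , earliest) none
  ... | yes (t′ , earliest′) with Earliest-unique earliest′ earliest
  ...   | refl = refl

  at-reverseWhen-none : ∀ {P p s} → (∀ t → t < s → ¬ Earliest P t) →
    at (reverseWhen P p) s ≡ at p s
  at-reverseWhen-none {P} {p} {s} none with decide (∃ (Earliest P))
  ... | no  _ = refl
  ... | yes (t , earliest) = reverse-before t p (≮⇒≥ (λ t<s → none t t<s earliest))

  Earliest-local : ∀ {P Q s t} →
    (∀ r → 0# ≤ r → r < s → P r → Q r) → (∀ r → 0# ≤ r → r < s → Q r → P r) →
    t < s → Earliest P t → Earliest Q t
  Earliest-local {P} {Q} {s} {t} P⇒Q Q⇒P t<s (0≤t , Pt , least) =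
    0≤t , P⇒Q t 0≤t t<s Pt , least′
    where
    least′ : ∀ r → 0# ≤ r → Q r → t ≤ r
    least′ r 0≤r Qr = ≮⇒≥ λ r<t → <⇒≱ r<t (least r 0≤r (Q⇒P r 0≤r (<-≤-trans r<t (<⇒≤ t<s)) Qr))

  -- A reversal at time r does not yet move the robot at time r, so the position at `s` depends only
  -- on triggers strictly before `s`. This is the form of causality that an `Algorithm` requires.
  reverseWhen-cong : ∀ {P Q p q s} →
    (∀ r → 0# ≤ r → r < s → P r → Q r) → (∀ r → 0# ≤ r → r < s → Q r → P r) →
    (∀ r → 0# ≤ r → r ≤ s → at p r ≡ at q r) → 0# ≤ s →
    at (reverseWhen P p) s ≡ at (reverseWhen Q q) s
  reverseWhen-cong {P} {Q} {p} {q} {s} P⇒Q Q⇒P p≗q 0≤s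
    with decide (∃[ t ] t < s × Earliest P t)
  ... | yes (t , t<s , earliest) = begin
    at (reverseWhen P p) s    ≡⟨ at-reverseWhen earliest s ⟩
    reverse-at t p s          ≡⟨ reverse-after t p t≤s ⟩
    at p t + at p t - at p s  ≡⟨ cong₂ (λ x y → x + x - y) (p≗q t (proj₁ earliest) t≤s) (p≗q s 0≤s ≤-refl) ⟩
    at q t + at q t - at q s  ≡⟨ sym (reverse-after t q t≤s) ⟩
    reverse-at t q s          ≡⟨ sym (at-reverseWhen (Earliest-local P⇒Q Q⇒P t<s earliest) s) ⟩
    at (reverseWhen Q q) s    ∎
    where
    open ≡-Reasoning
    t≤s = <⇒≤ t<s
  ... | no none = begin
    at (reverseWhen P p) s    ≡⟨ at-reverseWhen-none (λ t t<s e → none (t , t<s , e)) ⟩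
    at p s                    ≡⟨ p≗q s 0≤s ≤-refl ⟩
    at q s                    ≡⟨ sym (at-reverseWhen-none
                                   (λ t t<s e → none (t , t<s , Earliest-local Q⇒P P⇒Q t<s e))) ⟩
    at (reverseWhen Q q) s    ∎
    where open ≡-Reasoning

  -- The infimum of the visiting times is itself a visiting time, because a
  -- robot at distance e from x needs at least e more time to reach x.
  firstVisit : ∀ p {x t} → 0# ≤ t → at p t ≡ x →
    ∃[ s ] 0# ≤ s × s ≤ t × FirstVisit p x s
  firstVisit p {x} {t} 0≤t pt≡x = m , 0≤m , m≤t , pm≡x , first
    where
    Visit : Carrier → Set
    Visit s = 0# ≤ s × at p s ≡ x
    Lower : Carrier → Set
    Lower b = ∀ s → Visit s → b ≤ s
    infimum = complete Lower (0# , λ _ → proj₁) (t , λ b lower → lower t (0≤t , pt≡x))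
    m = proj₁ infimum
    m-lower : Lower m
    m-lower s visit = proj₂ (proj₂ infimum) s (λ b lower → lower s visit)
    0≤m : 0# ≤ m
    0≤m = proj₁ (proj₂ infimum) 0# (λ _ → proj₁)
    m≤t : m ≤ t
    m≤t = m-lower t (0≤t , pt≡x)
    reach : ∀ e → (∀ s → Visit s → e ≤ s - m) → e ≤ 0#
    reach e far = shift-≤ (proj₁ (proj₂ infimum) (m + e) (λ s visit → shift-≤ (far s visit)
        (solve 3 (λ s m e → s :- (m :+ e) := s :- m :- e) refl s m e)))
      (solve 2 (λ m e → con (ℤ.+ 0) :- e := m :- (m :+ e)) refl m e)
    pm≡x : at p m ≡ x
    pm≡x = antisym
      (shift-≤ (reach (at p m - x) λ { s (0≤s , refl) → proj₂ (speed p 0≤m (m-lower s (0≤s , refl))) })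
        (solve 2 (λ a b → b :- a := con (ℤ.+ 0) :- (a :- b)) refl (at p m) x))
      (shift-≤ (reach (x - at p m) λ { s (0≤s , refl) → proj₁ (speed p 0≤m (m-lower s (0≤s , refl))) })
        (solve 2 (λ a b → a :- b := con (ℤ.+ 0) :- (b :- a)) refl (at p m) x))
    first : ∀ s → 0# ≤ s → s < m → at p s ≢ x
    first s 0≤s s<m ps≡x = <⇒≱ s<m (m-lower s (0≤s , ps≡x))

  -- The minimum is taken over those candidates that are nonnegative and satisfy `P`; the list may
  -- contain others, such as default values.
  Earliest-exists : ∀ {P m} (c : Fin m → Carrier) →
    (∀ {t} → 0# ≤ t → P t → ∃[ i ] c i ≡ t) →
    ∀ {t} → 0# ≤ t → P t → ∃[ s ] s ≤ t × Earliest P s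
  Earliest-exists {P} c covers 0≤t Pt with covers 0≤t Pt
  ... | i , refl with smallest c i (0≤t , Pt)
    where
    smallest : ∀ {m} (c : Fin m → Carrier) i → 0# ≤ c i × P (c i) →
      ∃[ j ] (0# ≤ c j × P (c j)) × (∀ k → 0# ≤ c k → P (c k) → c j ≤ c k)
    smallest {suc m} c i ok with decide (∃[ k ] 0# ≤ c (suc k) × P (c (suc k)))
    ... | no none = pick i ok
      where
      pick : ∀ i → 0# ≤ c i × P (c i) →
        ∃[ j ] (0# ≤ c j × P (c j)) × (∀ k → 0# ≤ c k → P (c k) → c j ≤ c k)
      pick zero    ok = zero , ok , λ
        { zero    _   _  → ≤-refl
        ; (suc k) 0≤c Pc → contradiction (k , 0≤c , Pc) none }
      pick (suc k) ok = contradiction (k , ok) none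
    ... | yes (k , ok-k) with smallest (c ∘ suc) k ok-k | decide (0# ≤ c zero × P (c zero))
    ...   | j , ok-j , least | no  ¬ok = suc j , ok-j , λ
      { zero    0≤c Pc → contradiction (0≤c , Pc) ¬ok
      ; (suc l)        → least l }
    ...   | j , ok-j , least | yes ok₀ with total (c zero) (c (suc j))
    ...     | inj₁ c₀≤ = zero , ok₀ , λ
      { zero    _   _  → ≤-refl
      ; (suc l) 0≤c Pc → ≤-trans c₀≤ (least l 0≤c Pc) }
    ...     | inj₂ ≤c₀ = suc j , ok-j , λ
      { zero    _   _  → ≤c₀
      ; (suc l)        → least l }
  ...   | j , (0≤cj , Pcj) , least = c j , least i 0≤t Pt , 0≤cj , Pcj , least′
    where
    least′ : ∀ s → 0# ≤ s → P s → c j ≤ s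
    least′ s 0≤s Ps with covers 0≤s Ps
    ... | k , refl = least k 0≤s Ps

-- The Archimedean property, ceilings, and the number of robots

module Ceiling (em : ExcludedMiddle 0ℓ) (ℝ : CompleteOrderedField) where
  open Motion em ℝ
  open Solver using (solve; _:+_; _:-_; :-_; _:=_; _:*_; con)

  *-monoʳ-≤ : ∀ {x y z} → 0# ≤ z → x ≤ y → z * x ≤ z * y
  *-monoʳ-≤ {x} {y} {z} 0≤z x≤y = 0≤-⇒≤ (subst (0# ≤_)
    (solve 3 (λ x y z → z :* (y :- x) := z :* y :- z :* x) refl x y z) (*-nonNeg 0≤z (≤⇒0≤- x≤y)))

  0<1 : 0# < 1#
  0<1 = 0≤1 , 0#≢1#
    where
    0≤1 : 0# ≤ 1#
    0≤1 with total 0# 1#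
    ... | inj₁ 0≤1 = 0≤1
    ... | inj₂ 1≤0 = subst (0# ≤_)
      (trans (solve 1 (λ x → (con (ℤ.+ 0) :- x) :* (con (ℤ.+ 0) :- x) := x :* x) refl 1#) (*-identityʳ 1#))
      (*-nonNeg (≤⇒0≤- 1≤0) (≤⇒0≤- 1≤0))

  x<x+1 : ∀ x → x < x + 1#
  x<x+1 x = ≰⇒> λ x+1≤x → <⇒≱ 0<1 (shift-≤ x+1≤x
    (solve 2 (λ x o → con (ℤ.+ 0) :- o := x :- (x :+ o)) refl x 1#))

  fromℕ-nonNeg : ∀ n → 0# ≤ fromℕ n
  fromℕ-nonNeg zero    = ≤-refl
  fromℕ-nonNeg (suc n) = +-nonNeg (<⇒≤ 0<1) (fromℕ-nonNeg n)

  fromℕ-suc : ∀ n → fromℕ n < fromℕ (suc n)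
  fromℕ-suc n = subst (fromℕ n <_) (+-comm (fromℕ n) 1#) (x<x+1 (fromℕ n))

  fromℕ-mono-≤ : ∀ {m n} → m ℕ.≤ n → fromℕ m ≤ fromℕ n
  fromℕ-mono-≤ {n = n} ℕ.z≤n = fromℕ-nonNeg n
  fromℕ-mono-≤ (ℕ.s≤s m≤n)   = +-mono-≤ ≤-refl (fromℕ-mono-≤ m≤n)

  fromℕ-cancel-≤ : ∀ {m n} → fromℕ m ≤ fromℕ n → m ℕ.≤ n
  fromℕ-cancel-≤ {m} {n} m≤n with m ℕ.≤? n
  ... | yes p = p
  ... | no  m≰n = contradiction m≤n (<⇒≱ (<-≤-trans (fromℕ-suc n) (fromℕ-mono-≤ (ℕ.≰⇒> m≰n))))

  -- Otherwise the naturals have a supremum s; since n + 1 ≤ s for every n, the smaller number s - 1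
  -- bounds them as well.
  archimedean : ∀ x → ∃[ n ] x ≤ fromℕ n
  archimedean x with decide (∃[ n ] x ≤ fromℕ n)
  ... | yes bounded = bounded
  ... | no  unbounded = contradiction s≤s-1 (<⇒≱ s-1<s)
    where
    Natural : Carrier → Set
    Natural y = ∃[ n ] y ≡ fromℕ n
    supremum = complete Natural (0# , 0 , refl)
      (x , λ { _ (n , refl) → <⇒≤ (≰⇒> λ x≤n → unbounded (n , x≤n)) })
    s = proj₁ supremum
    s≤s-1 : s ≤ s - 1#
    s≤s-1 = proj₂ (proj₂ supremum) (s - 1#) λ { _ (n , refl) →
      shift-≤ (proj₁ (proj₂ supremum) _ (suc n , refl))
        (solve 3 (λ s o m → s :- o :- m := s :- (o :+ m)) refl s 1# (fromℕ n)) }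
    s-1<s : s - 1# < s
    s-1<s = subst (s - 1# <_) (solve 2 (λ s o → s :- o :+ o := s) refl s 1#) (x<x+1 (s - 1#))

  ceiling : ∀ {x} → 0# ≤ x → ∃[ n ] IsCeiling x n
  ceiling {x} 0≤x = descend (proj₁ (archimedean x)) (proj₂ (archimedean x))
    where
    descend : ∀ n → x ≤ fromℕ n → ∃[ m ] IsCeiling x m
    descend zero    x≤0 = zero , x≤0 , ≤-<-trans 0≤x (x<x+1 x)
    descend (suc n) x≤n with x ≤? fromℕ n
    ... | yes x≤m = descend n x≤m
    ... | no  x≰m = suc n , x≤n , ≰⇒> λ x+1≤n → x≰m (shift-≤ x+1≤n
      (solve 3 (λ x o m → m :- x := o :+ m :- (x :+ o)) refl x 1# (fromℕ n)))

  fromℕ-suc≢0 : ∀ n → fromℕ (suc n) ≢ 0#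
  fromℕ-suc≢0 n eq = <⇒≱ (≤-<-trans (fromℕ-nonNeg n) (fromℕ-suc n)) (≤-reflexive eq)

  ⁻¹-nonNeg : ∀ {x} → 0# < x → 0# ≤ x ⁻¹
  ⁻¹-nonNeg {x} 0<x with total 0# (x ⁻¹)
  ... | inj₁ 0≤x⁻¹ = 0≤x⁻¹
  ... | inj₂ x⁻¹≤0 = contradiction (subst₂ _≤_ (*-inverseʳ x (λ x≡0 → proj₂ 0<x (sym x≡0))) (zeroʳ x)
    (*-monoʳ-≤ (<⇒≤ 0<x) x⁻¹≤0)) (<⇒≱ 0<1)

  -- Rounding f up to the multiple 5 (f / 5 + 1) of 5 costs at most 14 extra robots.
  robots-needed : ∀ {β} f {n} → 0# < β → β ≤ fromℕ 5 / fromℕ 14 →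
    fromℕ f / β + fromℕ 14 ≤ fromℕ n → 14 ℕ.* suc (f ℕ./ 5) ℕ.≤ n
  robots-needed {β} f {n} 0<β β≤5/14 enough = ℕ.*-cancelˡ-≤ 5 (begin
    5 ℕ.* (14 ℕ.* suc (f ℕ./ 5))        ≡⟨ arith ⟩
    14 ℕ.* (f ℕ./ 5 ℕ.* 5) ℕ.+ 70       ≤⟨ ℕ.+-monoˡ-≤ 70 (ℕ.*-monoʳ-≤ 14 (ℕ.m/n*n≤m f 5)) ⟩
    14 ℕ.* f ℕ.+ 70                     ≤⟨ fromℕ-cancel-≤ real ⟩
    5 ℕ.* n                             ∎)
    where
    open ℕ.≤-Reasoning
    arith : 5 ℕ.* (14 ℕ.* suc (f ℕ./ 5)) ≡ 14 ℕ.* (f ℕ./ 5 ℕ.* 5) ℕ.+ 70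
    arith = S.solve 1 (λ m → S.con 5 S.:* (S.con 14 S.:* (S.con 1 S.:+ m)) S.:=
      S.con 14 S.:* (m S.:* S.con 5) S.:+ S.con 70) refl (f ℕ./ 5)
      where module S = +-*-Solver
    q = fromℕ f / β
    0≤q : 0# ≤ q
    0≤q = *-nonNeg (fromℕ-nonNeg f) (⁻¹-nonNeg 0<β)
    qβ≡f : q * β ≡ fromℕ f
    qβ≡f = trans (*-assoc _ _ _) (trans (cong (fromℕ f *_) (trans (*-comm _ _)
      (*-inverseʳ β (λ β≡0 → proj₂ 0<β (sym β≡0))))) (*-identityʳ _))
    14β≤5 : fromℕ 14 * β ≤ fromℕ 5
    14β≤5 = subst (fromℕ 14 * β ≤_) cancel (*-monoʳ-≤ (fromℕ-nonNeg 14) β≤5/14)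
      where
      cancel : fromℕ 14 * (fromℕ 5 / fromℕ 14) ≡ fromℕ 5
      cancel = trans (trans (*-comm _ _) (trans (*-assoc _ _ _) (cong (fromℕ 5 *_)
        (trans (*-comm _ _) (*-inverseʳ (fromℕ 14) (fromℕ-suc≢0 13)))))) (*-identityʳ (fromℕ 5))
    14f≤5q : fromℕ 14 * fromℕ f ≤ fromℕ 5 * q
    14f≤5q = subst₂ _≤_
      (trans (solve 2 (λ q b → q :* (con (ℤ.+ 14) :* b) := con (ℤ.+ 14) :* (q :* b)) refl q β)
        (cong (fromℕ 14 *_) qβ≡f))
      (*-comm q (fromℕ 5)) (*-monoʳ-≤ 0≤q 14β≤5)
    real : fromℕ (14 ℕ.* f ℕ.+ 70) ≤ fromℕ (5 ℕ.* n)
    real = subst₂ _≤_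
      (sym (trans (fromℕ-+ (14 ℕ.* f) 70) (cong (_+ fromℕ 70) (fromℕ-* 14 f))))
      (sym (fromℕ-* 5 n))
      (shift-≤₂ 14f≤5q (*-monoʳ-≤ (fromℕ-nonNeg 5) enough)
        (solve 3 (λ m f q → con (ℤ.+ 5) :* m :- (con (ℤ.+ 14) :* f :+ con (ℤ.+ 70)) :=
          (con (ℤ.+ 5) :* q :- con (ℤ.+ 14) :* f) :+
          (con (ℤ.+ 5) :* m :- con (ℤ.+ 5) :* (q :+ con (ℤ.+ 14)))) refl (fromℕ n) (fromℕ f) q))

-- Counting in finite sets

∣p∪q∣+∣p∩q∣≡∣p∣+∣q∣ : ∀ {n} (p q : Subset n) → ∣ p ∪ q ∣ ℕ.+ ∣ p ∩ q ∣ ≡ ∣ p ∣ ℕ.+ ∣ q ∣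
∣p∪q∣+∣p∩q∣≡∣p∣+∣q∣ []            []            = refl
∣p∪q∣+∣p∩q∣≡∣p∣+∣q∣ (outside ∷ p) (outside ∷ q) = ∣p∪q∣+∣p∩q∣≡∣p∣+∣q∣ p q
∣p∪q∣+∣p∩q∣≡∣p∣+∣q∣ (inside  ∷ p) (outside ∷ q) = cong suc (∣p∪q∣+∣p∩q∣≡∣p∣+∣q∣ p q)
∣p∪q∣+∣p∩q∣≡∣p∣+∣q∣ (outside ∷ p) (inside  ∷ q) =
  trans (cong suc (∣p∪q∣+∣p∩q∣≡∣p∣+∣q∣ p q)) (sym (ℕ.+-suc ∣ p ∣ ∣ q ∣))
∣p∪q∣+∣p∩q∣≡∣p∣+∣q∣ (inside  ∷ p) (inside  ∷ q) = cong suc (begin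
  ∣ p ∪ q ∣ ℕ.+ suc ∣ p ∩ q ∣    ≡⟨ ℕ.+-suc ∣ p ∪ q ∣ ∣ p ∩ q ∣ ⟩
  suc (∣ p ∪ q ∣ ℕ.+ ∣ p ∩ q ∣)  ≡⟨ cong suc (∣p∪q∣+∣p∩q∣≡∣p∣+∣q∣ p q) ⟩
  suc (∣ p ∣ ℕ.+ ∣ q ∣)          ≡⟨ sym (ℕ.+-suc ∣ p ∣ ∣ q ∣) ⟩
  ∣ p ∣ ℕ.+ suc ∣ q ∣            ∎)
  where open ≡-Reasoning

∣p∩q∣+∣p∩∁q∣≡∣p∣ : ∀ {n} (p q : Subset n) → ∣ p ∩ q ∣ ℕ.+ ∣ p ∩ ∁ q ∣ ≡ ∣ p ∣
∣p∩q∣+∣p∩∁q∣≡∣p∣ []            []            = refl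
∣p∩q∣+∣p∩∁q∣≡∣p∣ (outside ∷ p) (outside ∷ q) = ∣p∩q∣+∣p∩∁q∣≡∣p∣ p q
∣p∩q∣+∣p∩∁q∣≡∣p∣ (outside ∷ p) (inside  ∷ q) = ∣p∩q∣+∣p∩∁q∣≡∣p∣ p q
∣p∩q∣+∣p∩∁q∣≡∣p∣ (inside  ∷ p) (outside ∷ q) =
  trans (ℕ.+-suc ∣ p ∩ q ∣ ∣ p ∩ ∁ q ∣) (cong suc (∣p∩q∣+∣p∩∁q∣≡∣p∣ p q))
∣p∩q∣+∣p∩∁q∣≡∣p∣ (inside  ∷ p) (inside  ∷ q) = cong suc (∣p∩q∣+∣p∩∁q∣≡∣p∣ p q)

0<∣p∣⇒Nonempty : ∀ {n} {p : Subset n} → 0 ℕ.< ∣ p ∣ → Nonempty p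
0<∣p∣⇒Nonempty {n} {p} 0<∣p∣ with nonempty? p
... | yes p≢∅ = p≢∅
... | no  p≡∅ = contradiction (trans (cong ∣_∣ (Empty-unique p≡∅)) (∣⊥∣≡0 n)) (ℕ.>⇒≢ 0<∣p∣)

Disjoint : ∀ {n} → Subset n → Subset n → Set
Disjoint p q = ∀ {i} → i ∈ p → i ∉ q

Disjoint⇒∣p∩q∣≡0 : ∀ {n} (p q : Subset n) → Disjoint p q → ∣ p ∩ q ∣ ≡ 0
Disjoint⇒∣p∩q∣≡0 {n} p q disj = ℕ.n≤0⇒n≡0 (ℕ.≤-trans (p⊆q⇒∣p∣≤∣q∣ empty) (ℕ.≤-reflexive (∣⊥∣≡0 n)))
  where
  empty : (p ∩ q) ⊆ ⊥
  empty i∈ with x∈p∩q⁻ p q i∈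
  ... | i∈p , i∈q = contradiction i∈q (disj i∈p)

Disjoint⇒∣p∣+∣q∣≤ : ∀ {n} {p q r : Subset n} → Disjoint p q → p ⊆ r → q ⊆ r → ∣ p ∣ ℕ.+ ∣ q ∣ ℕ.≤ ∣ r ∣
Disjoint⇒∣p∣+∣q∣≤ {p = p} {q} {r} disj p⊆r q⊆r = begin
  ∣ p ∣ ℕ.+ ∣ q ∣          ≡⟨ sym (∣p∪q∣+∣p∩q∣≡∣p∣+∣q∣ p q) ⟩
  ∣ p ∪ q ∣ ℕ.+ ∣ p ∩ q ∣  ≡⟨ cong (∣ p ∪ q ∣ ℕ.+_) (Disjoint⇒∣p∩q∣≡0 p q disj) ⟩
  ∣ p ∪ q ∣ ℕ.+ 0          ≡⟨ ℕ.+-identityʳ _ ⟩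
  ∣ p ∪ q ∣                ≤⟨ p⊆q⇒∣p∣≤∣q∣ (λ i∈ → [ p⊆r , q⊆r ]′ (x∈p∪q⁻ p q i∈)) ⟩
  ∣ r ∣                    ∎
  where open ℕ.≤-Reasoning

-- Inclusion-exclusion: `d` contributes once to the union and once more to the intersection. In the
-- application `p` and `q` are the faulty sets of two rival scenarios, `s` consists of visitors and
-- `d` of robots that lie in both scenarios.
double-count : ∀ {n} {s d p q : Subset n} → Disjoint s d →
  s ⊆ p ∪ q → d ⊆ p → d ⊆ q → ∣ s ∣ ℕ.+ (∣ d ∣ ℕ.+ ∣ d ∣) ℕ.≤ ∣ p ∣ ℕ.+ ∣ q ∣
double-count {s = s} {d} {p} {q} disj s⊆ d⊆p d⊆q = begin
  ∣ s ∣ ℕ.+ (∣ d ∣ ℕ.+ ∣ d ∣)  ≡⟨ sym (ℕ.+-assoc ∣ s ∣ _ _) ⟩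
  ∣ s ∣ ℕ.+ ∣ d ∣ ℕ.+ ∣ d ∣    ≤⟨ ℕ.+-mono-≤
    (Disjoint⇒∣p∣+∣q∣≤ disj s⊆ (λ i∈d → x∈p∪q⁺ (inj₁ (d⊆p i∈d))))
    (p⊆q⇒∣p∣≤∣q∣ {q = p ∩ q} (λ i∈d → x∈p∩q⁺ (d⊆p i∈d , d⊆q i∈d))) ⟩
  ∣ p ∪ q ∣ ℕ.+ ∣ p ∩ q ∣      ≡⟨ ∣p∪q∣+∣p∩q∣≡∣p∣+∣q∣ p q ⟩
  ∣ p ∣ ℕ.+ ∣ q ∣              ∎
  where open ℕ.≤-Reasoning

∣p++q∣ : ∀ {m n} (p : Subset m) (q : Subset n) → ∣ p ++ q ∣ ≡ ∣ p ∣ ℕ.+ ∣ q ∣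
∣p++q∣ []            q = refl
∣p++q∣ (inside  ∷ p) q = cong suc (∣p++q∣ p q)
∣p++q∣ (outside ∷ p) q = ∣p++q∣ p q

-- This reduces the size of any team to a count in the list of ranks, which evaluates to a numeral,
-- times `k`.
∣map-replicate∣ : ∀ {A : Set} {m n} (P : A → Bool) k (xs : Vec A m) (y : A) → P y ≡ outside →
  ∣ map P (concat (map (replicate k) xs) ++ replicate n y) ∣ ≡ ∣ map P xs ∣ ℕ.* k
∣map-replicate∣ {n = n} P k [] y ¬Py = trans
  (cong ∣_∣ (trans (map-replicate P y n) (cong (replicate n) ¬Py))) (∣⊥∣≡0 n)
∣map-replicate∣ {n = n} P k (x ∷ xs) y ¬Py = begin
  ∣ map P ((replicate k x ++ ys) ++ zs) ∣       ≡⟨ cong ∣_∣ (map-++ P (replicate k x ++ ys) zs) ⟩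
  ∣ map P (replicate k x ++ ys) ++ map P zs ∣   ≡⟨ ∣p++q∣ (map P (replicate k x ++ ys)) (map P zs) ⟩
  ∣ map P (replicate k x ++ ys) ∣ ℕ.+ ∣ map P zs ∣
    ≡⟨ cong (ℕ._+ ∣ map P zs ∣) (trans (cong ∣_∣ (map-++ P (replicate k x) ys)) (∣p++q∣ (map P (replicate k x)) (map P ys))) ⟩
  ∣ map P (replicate k x) ∣ ℕ.+ ∣ map P ys ∣ ℕ.+ ∣ map P zs ∣
    ≡⟨ ℕ.+-assoc ∣ map P (replicate k x) ∣ _ _ ⟩
  ∣ map P (replicate k x) ∣ ℕ.+ (∣ map P ys ∣ ℕ.+ ∣ map P zs ∣)
    ≡⟨ cong₂ ℕ._+_ (cong ∣_∣ (map-replicate P x k))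
         (trans (sym (∣p++q∣ (map P ys) (map P zs))) (trans (cong ∣_∣ (sym (map-++ P ys zs)))
           (∣map-replicate∣ P k xs y ¬Py))) ⟩
  ∣ replicate k (P x) ∣ ℕ.+ ∣ map P xs ∣ ℕ.* k
    ≡⟨ block (P x) ⟩
  ∣ map P (x ∷ xs) ∣ ℕ.* k                      ∎
  where
  open ≡-Reasoning
  ys = concat (map (replicate k) xs)
  zs = replicate n y
  block : ∀ b → ∣ replicate k b ∣ ℕ.+ ∣ map P xs ∣ ℕ.* k ≡ ∣ b ∷ map P xs ∣ ℕ.* k
  block inside  = cong (ℕ._+ ∣ map P xs ∣ ℕ.* k) (∣⊤∣≡n k)
  block outside = cong (ℕ._+ ∣ map P xs ∣ ℕ.* k) (∣⊥∣≡0 k)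

-- The composition of the crew

data Rank : Set where
  lead follow return : Rank

data Duty : Set where
  idle : Duty
  on   : Side → Rank → Duty

ranks : Vec Rank 7
ranks = lead ∷ lead ∷ lead ∷ lead ∷ follow ∷ return ∷ return ∷ []

module Crew (k r : ℕ) where

  roster : Vec Duty 14
  roster = map (on left) ranks ++ map (on right) ranks

  crew : Vec Duty (14 ℕ.* k ℕ.+ r)
  crew = concat (map (replicate k) roster) ++ replicate r idle

  duty : Fin (14 ℕ.* k ℕ.+ r) → Duty
  duty = lookup crew

  nobody everyone leads nonleads follows outer : Rank → Bool
  nobody _ = false
  everyone _ = true
  leads lead = true
  leads _    = false
  nonleads lead = false
  nonleads _    = true
  follows follow = true
  follows _      = false
  outer follow = false
  outer _      = true

  -- Ranks are chosen relative to a side, later the side that turns, so that each count is made once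
  -- for both orientations.
  selects : Side → (own other : Rank → Bool) → Duty → Bool
  selects ρ     own other idle         = false
  selects left  own other (on left  x) = own x
  selects left  own other (on right x) = other x
  selects right own other (on right x) = own x
  selects right own other (on left  x) = other x

  squad : Side → (own other : Rank → Bool) → Subset (14 ℕ.* k ℕ.+ r)
  squad ρ own other = map (selects ρ own other) crew

  squad⁻ : ∀ ρ own other {i} → i ∈ squad ρ own other →
    (∃[ x ] duty i ≡ on ρ x × own x ≡ true) ⊎ (∃[ x ] duty i ≡ on (opposite ρ) x × other x ≡ true)
  squad⁻ ρ own other {i} i∈ = cases ρ (duty i) refl
    (trans (sym (lookup-map i (selects ρ own other) crew)) ([]=⇒lookup i∈))
    where
    cases : ∀ ρ d → duty i ≡ d → selects ρ own other d ≡ true →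
      (∃[ x ] duty i ≡ on ρ x × own x ≡ true) ⊎ (∃[ x ] duty i ≡ on (opposite ρ) x × other x ≡ true)
    cases left  (on left  x) eq ok = inj₁ (x , eq , ok)
    cases left  (on right x) eq ok = inj₂ (x , eq , ok)
    cases right (on right x) eq ok = inj₁ (x , eq , ok)
    cases right (on left  x) eq ok = inj₂ (x , eq , ok)

  ∣squad∣ : ∀ ρ own other →
    ∣ squad ρ own other ∣ ≡ (∣ map own ranks ∣ ℕ.+ ∣ map other ranks ∣) ℕ.* k
  ∣squad∣ left  own other =
    trans (∣map-replicate∣ (selects left own other) k roster idle refl)
      (cong (ℕ._* k) (∣p++q∣ (map own ranks) (map other ranks)))
  ∣squad∣ right own other =
    trans (∣map-replicate∣ (selects right own other) k roster idle refl)
      (cong (ℕ._* k) (trans (∣p++q∣ (map other ranks) (map own ranks)) (ℕ.+-comm ∣ map other ranks ∣ _)))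

-- The strategy, its causality, and the arrival times

module Strategy (em : ExcludedMiddle 0ℓ) (ℝ : CompleteOrderedField) (k r : ℕ) where
  open Motion em ℝ public
  open Crew k r public

  n : ℕ
  n = 14 ℕ.* k ℕ.+ r

  FirstCall : Transcript n → Fin n → Carrier → Carrier → Set
  FirstCall H i t x = H i t ≡ just x × (∀ s → 0# ≤ s → s < t → H i s ≡ nothing)

  -- Reliable robots that have marched without turning reach a target at distance t all at time t. A
  -- genuine quorum is therefore simultaneous, and one number `t` serves as its time and its
  -- distance.
  Quorum : ℕ → Subset n → Side → Transcript n → Carrier → Set
  Quorum θ team ρ H t = ∃[ D ] D ⊆ team × θ ℕ.≤ ∣ D ∣ ×
    (∀ {i} → i ∈ D → FirstCall H i t (signed ρ t))

  Alarm : Transcript n → Side → Carrier → Set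
  Alarm H σ = Quorum (2 ℕ.* k) (squad σ everyone nobody) σ H

  -- Of two simultaneous first alarms, the one on the right counts.
  Turn : Transcript n → Side → Carrier → Set
  Turn H left  t = Alarm H right t × (∀ s → 0# ≤ s → s < t → ¬ Alarm H left s)
  Turn H right t = Alarm H left  t × (∀ s → 0# ≤ s → s ≤ t → ¬ Alarm H right s)

  -- Only leads are consulted: they never turn, so the reliable ones are sure to pass every point of
  -- their side on schedule. The turn may coincide with `u`; the two reversals then cancel.
  Return : Transcript n → Side → Carrier → Set
  Return H ρ u = (∃[ t ] 0# ≤ t × t ≤ u × Turn H ρ t) × Quorum k (squad ρ leads nobody) ρ H u

  motion : Transcript n → Duty → Trajectory
  motion H idle          = rest
  motion H (on ρ lead)   = march ρ
  motion H (on ρ follow) = reverseWhen (Turn H ρ) (march ρ)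
  motion H (on ρ return) = reverseWhen (Return H ρ) (motion H (on ρ follow))

  Quorum-local : ∀ {θ team} ρ {H H′ s t} → AgreeBefore s H H′ → 0# ≤ t → t < s →
    Quorum θ team ρ H t → Quorum θ team ρ H′ t
  Quorum-local ρ agree 0≤t t<s (D , D⊆ , θ≤ , calls) = D , D⊆ , θ≤ , λ {i} i∈D →
    trans (sym (agree i _ 0≤t t<s)) (proj₁ (calls i∈D)) ,
    λ r 0≤r r<t → trans (sym (agree i r 0≤r (<-≤-trans r<t (<⇒≤ t<s)))) (proj₂ (calls i∈D) r 0≤r r<t)

  AgreeBefore-sym : ∀ {H H′ : Transcript n} {s} → AgreeBefore s H H′ → AgreeBefore s H′ H
  AgreeBefore-sym agree j s 0≤s s<t = sym (agree j s 0≤s s<t)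

  Turn-local : ∀ {ρ H H′ s t} → AgreeBefore s H H′ → 0# ≤ t → t < s → Turn H ρ t → Turn H′ ρ t
  Turn-local {left} agree 0≤t t<s (alarm , none) = Quorum-local right agree 0≤t t<s alarm ,
    λ r 0≤r r<t alarm′ → none r 0≤r r<t
      (Quorum-local left (AgreeBefore-sym agree) 0≤r (<-≤-trans r<t (<⇒≤ t<s)) alarm′)
  Turn-local {right} agree 0≤t t<s (alarm , none) = Quorum-local left agree 0≤t t<s alarm ,
    λ r 0≤r r≤t alarm′ → none r 0≤r r≤t
      (Quorum-local right (AgreeBefore-sym agree) 0≤r (≤-<-trans r≤t t<s) alarm′)

  Return-local : ∀ {ρ H H′ s u} → AgreeBefore s H H′ → 0# ≤ u → u < s → Return H ρ u → Return H′ ρ u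
  Return-local {ρ} agree 0≤u u<s ((t , 0≤t , t≤u , turn) , quorum) =
    (t , 0≤t , t≤u , Turn-local agree 0≤t (≤-<-trans t≤u u<s) turn) ,
    Quorum-local ρ agree 0≤u u<s quorum

  motion-causal : ∀ H H′ d {t} → 0# ≤ t → AgreeBefore t H H′ → at (motion H d) t ≡ at (motion H′ d) t
  motion-causal H H′ idle          0≤t agree = refl
  motion-causal H H′ (on ρ lead)   0≤t agree = refl
  motion-causal H H′ (on ρ follow) 0≤t agree = reverseWhen-cong
    (λ r 0≤r r<t → Turn-local agree 0≤r r<t)
    (λ r 0≤r r<t → Turn-local (AgreeBefore-sym agree) 0≤r r<t)
    (λ _ _ _ → refl) 0≤t
  motion-causal H H′ (on ρ return) 0≤t agree = reverseWhen-cong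
    (λ r 0≤r r<t → Return-local agree 0≤r r<t)
    (λ r 0≤r r<t → Return-local (AgreeBefore-sym agree) 0≤r r<t)
    (λ r 0≤r r≤t → motion-causal H H′ (on ρ follow) 0≤r
      (λ j s 0≤s s<r → agree j s 0≤s (<-≤-trans s<r r≤t))) 0≤t

  algorithm : Algorithm n
  algorithm = record
    { assign = λ H i → motion H (duty i)
    ; causal = λ H H′ i → motion-causal H H′ (duty i)
    }

  -- The tie-break leaves only one alarm side in force. Its whole team of 7k therefore marches on,
  -- and can be counted in full at any point it passes.
  Turn-exclusive : ∀ {ρ H s t} → 0# ≤ s → 0# ≤ t → Turn H ρ s → ¬ Turn H (opposite ρ) t
  Turn-exclusive {left}  0≤s 0≤t (right-alarm , no-left) (left-alarm , no-right) =
    no-right _ 0≤s (≮⇒≥ λ t<s → no-left _ 0≤t t<s left-alarm) right-alarm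
  Turn-exclusive {right} 0≤s 0≤t (left-alarm , no-right) (right-alarm , no-left) =
    no-right _ 0≤t (≮⇒≥ λ s<t → no-left _ 0≤s s<t left-alarm) right-alarm

  Turn⇒Alarm : ∀ {ρ H t} → Turn H ρ t → Alarm H (opposite ρ) t
  Turn⇒Alarm {left}  = proj₁
  Turn⇒Alarm {right} = proj₁

  motion-unturned : ∀ {H ρ s} → (∀ t → 0# ≤ t → t < s → ¬ Turn H ρ t) →
    ∀ x → at (motion H (on ρ x)) s ≡ signed ρ s
  motion-unturned none lead   = refl
  motion-unturned none follow = at-reverseWhen-none λ t t<s (0≤t , turn , _) → none t 0≤t t<s turn
  motion-unturned none return = trans
    (at-reverseWhen-none λ { u u<s (_ , ((t , 0≤t , t≤u , turn) , _) , _) →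
      none t 0≤t (≤-<-trans t≤u u<s) turn })
    (motion-unturned none follow)

  motion-follow : ∀ {H ρ s t} → Earliest (Turn H ρ) t → t ≤ s →
    at (motion H (on ρ follow)) s ≡ signed ρ t + signed ρ t - signed ρ s
  motion-follow {H} {ρ} {s} {t} turn t≤s = trans (at-reverseWhen turn s) (reverse-after t (march ρ) t≤s)

  open Solver using (solve; _:+_; _:-_; :-_; _:=_; _:*_; con)

  -- The way out and back to the origin takes t + t, the way to the other side another d.
  motion-crossing : ∀ {H ρ t d} → Earliest (Turn H ρ) t → 0# ≤ d →
    at (motion H (on ρ follow)) (d + (t + t)) ≡ signed (opposite ρ) d
  motion-crossing {H} {ρ} {t} {d} turn 0≤d = trans
    (motion-follow turn (shift-≤₂ 0≤d (proj₁ turn)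
      (solve 2 (λ t d → d :+ (t :+ t) :- t := d :- con (ℤ.+ 0) :+ (t :- con (ℤ.+ 0))) refl t d)))
    (arrive ρ)
    where
    arrive : ∀ ρ → signed ρ t + signed ρ t - signed ρ (d + (t + t)) ≡ signed (opposite ρ) d
    arrive left  = solve 2 (λ t d → :- t :+ :- t :- (:- (d :+ (t :+ t))) := d) refl t d
    arrive right = solve 2 (λ t d → t :+ t :- (d :+ (t :+ t)) := :- d) refl t d

  -- Walking back from `t` to `u` and making up the lost ground each cost u - t, so the robot lags
  -- behind the march by twice that.
  motion-returning : ∀ {H ρ t u d} → Earliest (Turn H ρ) t → Earliest (Return H ρ) u → u ≤ d →
    at (motion H (on ρ return)) (d + ((u - t) + (u - t))) ≡ signed ρ d
  motion-returning {H} {ρ} {t} {u} {d} turn ret@(_ , ((t′ , 0≤t′ , t′≤u , turn′) , _) , _) u≤d = begin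
    at (motion H (on ρ return)) s           ≡⟨ at-reverseWhen ret s ⟩
    reverse-at u (motion H (on ρ follow)) s ≡⟨ reverse-after u (motion H (on ρ follow)) u≤s ⟩
    at (motion H (on ρ follow)) u + at (motion H (on ρ follow)) u - at (motion H (on ρ follow)) s
      ≡⟨ cong₂ (λ x y → x + x - y) (motion-follow turn t≤u) (motion-follow turn (≤-trans t≤u u≤s)) ⟩
    (ρt + ρt - ρu) + (ρt + ρt - ρu) - (ρt + ρt - signed ρ s) ≡⟨ arrive ρ ⟩
    signed ρ d                              ∎
    where
    open ≡-Reasoning
    s  = d + ((u - t) + (u - t))
    ρt = signed ρ t
    ρu = signed ρ u
    t≤u : t ≤ u
    -- Several alarms may satisfy `Turn`, so the time `t′` recorded in the return need not be the
    -- earliest one.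
    t≤u = ≤-trans (proj₂ (proj₂ turn) t′ 0≤t′ turn′) t′≤u
    u≤s : u ≤ s
    u≤s = ≤-trans u≤d (shift-≤₂ t≤u t≤u
      (solve 3 (λ t u d → d :+ ((u :- t) :+ (u :- t)) :- d := (u :- t) :+ (u :- t)) refl t u d))
    arrive : ∀ ρ → (signed ρ t + signed ρ t - signed ρ u) + (signed ρ t + signed ρ t - signed ρ u)
      - (signed ρ t + signed ρ t - signed ρ s) ≡ signed ρ d
    arrive left  = solve 3 (λ t u d → (:- t :+ :- t :- :- u) :+ (:- t :+ :- t :- :- u)
      :- (:- t :+ :- t :- (:- (d :+ ((u :- t) :+ (u :- t))))) := :- d) refl t u d
    arrive right = solve 3 (λ t u d → (t :+ t :- u) :+ (t :+ t :- u)
      :- (t :+ t :- (d :+ ((u :- t) :+ (u :- t)))) := d) refl t u d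

  FirstCall-unique : ∀ H {i s t x y} → 0# ≤ s → 0# ≤ t → FirstCall H i s x → FirstCall H i t y → s ≡ t
  FirstCall-unique H {s = s} {t} 0≤s 0≤t (call-s , before-s) (call-t , before-t) = antisym
    (≮⇒≥ λ t<s → case trans (sym call-t) (before-s t 0≤t t<s) of λ ())
    (≮⇒≥ λ s<t → case trans (sym call-s) (before-t s 0≤s s<t) of λ ())

  -- Each robot has at most one first call, so there are finitely many candidate
  -- times; faulty robots may announce at infinitely many times.
  Earliest-Quorum : ∀ {P H} → (∀ {t} → P t → ∃[ i ] ∃[ x ] FirstCall H i t x) →
    ∀ {t} → 0# ≤ t → P t → ∃[ s ] s ≤ t × Earliest P s
  Earliest-Quorum {P} {H} called = Earliest-exists callTime covers
    where
    Called : Fin n → Carrier → Set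
    Called i t = 0# ≤ t × ∃[ x ] FirstCall H i t x
    callTime : Fin n → Carrier
    callTime i with decide (∃ (Called i))
    ... | yes (t , _) = t
    ... | no  _       = 0#
    callTime-unique : ∀ {i t} → Called i t → callTime i ≡ t
    callTime-unique {i} {t} c@(0≤t , _ , call) with decide (∃ (Called i))
    ... | yes (s , 0≤s , _ , call′) = FirstCall-unique H 0≤s 0≤t call′ call
    ... | no  none = contradiction (t , c) none
    covers : ∀ {t} → 0# ≤ t → P t → ∃[ i ] callTime i ≡ t
    covers 0≤t Pt with called Pt
    ... | i , x , call = i , callTime-unique (0≤t , x , call)

  Quorum⇒FirstCall : ∀ {θ team ρ H t} → 0 ℕ.< θ → Quorum θ team ρ H t →
    ∃[ i ] ∃[ x ] FirstCall H i t x
  Quorum⇒FirstCall 0<θ (D , _ , θ≤ , calls) with 0<∣p∣⇒Nonempty (ℕ.≤-trans 0<θ θ≤)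
  ... | i , i∈D = i , _ , calls i∈D

-- What messages reveal about faulty robots

module Run (em : ExcludedMiddle 0ℓ) (ℝ : CompleteOrderedField) (k r : ℕ) where
  open Strategy em ℝ k r public

  module _ {f : ℕ} (E : Scenario algorithm f) where
    open Scenario E

    private
      H : Transcript n
      H = transcript

      x : Carrier
      x = target

    assigned : Fin n → Trajectory
    assigned i = motion H (duty i)

    heard : ∀ {i t z} → i ∉ faulty → 0# ≤ t → H i t ≡ just z → FirstVisit (path i) x t × z ≡ x
    heard {i} {t} i∉F 0≤t eq with announces i t in told
    heard {i} {t} i∉F 0≤t refl | true = visit , proj₁ visit
      where visit = Equivalence.to (truthful i∉F 0≤t) told

    announced : ∀ {i t} → i ∉ faulty → 0# ≤ t → FirstVisit (path i) x t → H i t ≡ just x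
    announced {i} {t} i∉F 0≤t visit
      rewrite Equivalence.from (truthful i∉F 0≤t) visit = cong just (proj₁ visit)

    visit-heard : ∀ {i t} → i ∉ faulty → 0# ≤ t → at (assigned i) t ≡ x →
      ∃[ s ] 0# ≤ s × s ≤ t × H i s ≡ just x
    visit-heard {i} i∉F 0≤t visit =
      let s , 0≤s , s≤t , first = firstVisit (path i) 0≤t (trans (obedient i∉F 0≤t) visit)
      in s , 0≤s , s≤t , announced i∉F 0≤s first

    honest-FirstCall : ∀ {i t ρ} → i ∉ faulty → 0# ≤ t → x ≡ signed ρ t →
      (∀ s → 0# ≤ s → s ≤ t → at (assigned i) s ≡ signed ρ s) → FirstCall H i t (signed ρ t)
    honest-FirstCall {i} {t} {ρ} i∉F 0≤t refl unturned = announced i∉F 0≤t (visit , fresh) , silent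
      where
      visit : at (path i) t ≡ x
      visit = trans (obedient i∉F 0≤t) (unturned t 0≤t ≤-refl)
      fresh : ∀ s → 0# ≤ s → s < t → at (path i) s ≢ x
      fresh s 0≤s s<t there = proj₂ s<t (signed-injective ρ
        (trans (sym (trans (obedient i∉F 0≤s) (unturned s 0≤s (<⇒≤ s<t)))) there))
      silent : ∀ s → 0# ≤ s → s < t → H i s ≡ nothing
      silent s 0≤s s<t with H i s in told
      ... | nothing = refl
      ... | just _  = contradiction (proj₁ (proj₁ (heard i∉F 0≤s told))) (fresh s 0≤s s<t)

    liar : ∀ {i t z} → 0# ≤ t → H i t ≡ just z → z ≢ x → i ∈ faulty
    liar {i} 0≤t told z≢x with i ∈? faulty
    ... | yes i∈F = i∈F
    ... | no  i∉F = contradiction (proj₂ (heard i∉F 0≤t told)) z≢x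

    -- The reliable members of the squad are themselves the quorum; their number is at least `θ` by
    -- the penultimate hypothesis, which avoids subtraction. As `θ` is positive, one of them also
    -- witnesses `Found`.
    Quorum-honest : ∀ θ ρ own other {t} → 0# ≤ t → x ≡ signed ρ t →
      (∀ {i} → i ∈ squad ρ own other → ∀ s → 0# ≤ s → s ≤ t → at (assigned i) s ≡ signed ρ s) →
      θ ℕ.+ ∣ squad ρ own other ∩ faulty ∣ ℕ.≤ ∣ squad ρ own other ∣ → 0 ℕ.< θ →
      Quorum θ (squad ρ own other) ρ H t × Found E t
    Quorum-honest θ ρ own other {t} 0≤t x≡ unturned enough 0<θ =
      (D , p∩q⊆p S (∁ faulty) , θ≤ , calls) , found
      where
      S = squad ρ own other
      D = S ∩ ∁ faulty
      θ≤ : θ ℕ.≤ ∣ D ∣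
      θ≤ = ℕ.+-cancelˡ-≤ ∣ S ∩ faulty ∣ _ _ (begin
        ∣ S ∩ faulty ∣ ℕ.+ θ     ≡⟨ ℕ.+-comm ∣ S ∩ faulty ∣ θ ⟩
        θ ℕ.+ ∣ S ∩ faulty ∣     ≤⟨ enough ⟩
        ∣ S ∣                    ≡⟨ sym (∣p∩q∣+∣p∩∁q∣≡∣p∣ S faulty) ⟩
        ∣ S ∩ faulty ∣ ℕ.+ ∣ D ∣ ∎)
        where open ℕ.≤-Reasoning
      honest : ∀ {i} → i ∈ D → i ∉ faulty
      honest i∈D = x∈∁p⇒x∉p (p∩q⊆q S (∁ faulty) i∈D)
      calls : ∀ {i} → i ∈ D → FirstCall H i t (signed ρ t)
      calls i∈D = honest-FirstCall {ρ = ρ} (honest i∈D) 0≤t x≡ (unturned (p∩q⊆p S (∁ faulty) i∈D))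
      found : Found E t
      found = let i , i∈D = 0<∣p∣⇒Nonempty (ℕ.≤-trans 0<θ θ≤) in
        i , honest i∈D , t , 0≤t , ≤-refl ,
        trans (proj₁ (calls i∈D)) (cong just (sym x≡))

  module _ {f T} (E E′ : Scenario algorithm f)
    (agree : AgreeUpTo T (Scenario.transcript E) (Scenario.transcript E′)) where
    private
      module E  = Scenario E
      module E′ = Scenario E′

    module _ (x≢x′ : E′.target ≢ E.target) where

      -- Equal messages give equal assigned positions, so a robot reliable in both scenarios would
      -- make the same visit in both. In the scenario whose target it visits it must announce it,
      -- and in the other that same announcement is a lie.
      caught : ∀ {i t} → 0# ≤ t → t ≤ T →
        at (assigned E i) t ≡ E.target ⊎ at (assigned E i) t ≡ E′.target → i ∈ E.faulty ∪ E′.faulty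
      caught {i} {t} 0≤t t≤T visit with i ∈? E.faulty | i ∈? E′.faulty
      ... | yes i∈F | _        = x∈p∪q⁺ (inj₁ i∈F)
      ... | no  _   | yes i∈F′ = x∈p∪q⁺ (inj₂ i∈F′)
      ... | no  i∉F | no  i∉F′ = contradiction visit [ not-x , not-x′ ]′
        where
        not-x : at (assigned E i) t ≢ E.target
        not-x visit-x = let s , 0≤s , s≤t , told = visit-heard E i∉F 0≤t visit-x in
          x≢x′ (sym (proj₂ (heard E′ i∉F′ 0≤s (trans (sym (agree i s 0≤s (≤-trans s≤t t≤T))) told))))
        same-position : at (assigned E i) t ≡ at (assigned E′ i) t
        same-position = motion-causal E.transcript E′.transcript (duty i) 0≤t
          (λ j s 0≤s s<t → agree j s 0≤s (≤-trans (<⇒≤ s<t) t≤T))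
        not-x′ : at (assigned E i) t ≢ E′.target
        not-x′ visit-x′ = let s , 0≤s , s≤t , told = visit-heard E′ i∉F′ 0≤t (trans (sym same-position) visit-x′) in
          x≢x′ (proj₂ (heard E i∉F 0≤s (trans (agree i s 0≤s (≤-trans s≤t t≤T)) told)))

      liar′ : ∀ {i t z} → 0# ≤ t → t ≤ T → E.transcript i t ≡ just z → z ≢ E′.target → i ∈ E′.faulty
      liar′ {i} 0≤t t≤T told = liar E′ 0≤t (trans (sym (agree i _ 0≤t t≤T)) told)

-- Excluding rival targets by time 3d

module Search≤3 (em : ExcludedMiddle 0ℓ) (ℝ : CompleteOrderedField) (k r f : ℕ) (f<5k : f ℕ.< 5 ℕ.* k) where
  open Run em ℝ k r public
  open Solver using (solve; _:+_; _:-_; :-_; _:=_; _:*_; con)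

  0<k : 0 ℕ.< k
  0<k = ℕ.*-cancelˡ-< 5 0 k (ℕ.≤-<-trans ℕ.z≤n f<5k)

  0<2k : 0 ℕ.< 2 ℕ.* k
  0<2k = ℕ.≤-trans 0<k (ℕ.m≤m+n k _)

  not-10k : ∀ {a b} → a ℕ.≤ f → b ℕ.≤ f → ¬ (10 ℕ.* k ℕ.≤ a ℕ.+ b)
  not-10k {a} {b} a≤f b≤f 10k≤ = ℕ.<-irrefl refl (begin-strict
    a ℕ.+ b                 ≤⟨ ℕ.+-mono-≤ a≤f b≤f ⟩
    f ℕ.+ f                 <⟨ ℕ.+-mono-< f<5k f<5k ⟩
    5 ℕ.* k ℕ.+ 5 ℕ.* k     ≡⟨ sym (ℕ.*-distribʳ-+ k 5 5) ⟩
    10 ℕ.* k                ≤⟨ 10k≤ ⟩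
    a ℕ.+ b                 ∎)
    where open ℕ.≤-Reasoning

  overcount-≤ : ∀ {p q s : Subset n} {m} → s ⊆ p ∪ q → ∣ s ∣ ≡ m ℕ.* k → 10 ℕ.≤ m → 10 ℕ.* k ℕ.≤ ∣ p ∣ ℕ.+ ∣ q ∣
  overcount-≤ {p} {q} {s} {m} s⊆ size 10≤m = begin
    10 ℕ.* k                  ≤⟨ ℕ.*-monoˡ-≤ k 10≤m ⟩
    m ℕ.* k                   ≡⟨ sym size ⟩
    ∣ s ∣                     ≤⟨ p⊆q⇒∣p∣≤∣q∣ s⊆ ⟩
    ∣ p ∪ q ∣                 ≤⟨ ℕ.m≤m+n ∣ p ∪ q ∣ ∣ p ∩ q ∣ ⟩
    ∣ p ∪ q ∣ ℕ.+ ∣ p ∩ q ∣   ≡⟨ ∣p∪q∣+∣p∩q∣≡∣p∣+∣q∣ p q ⟩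
    ∣ p ∣ ℕ.+ ∣ q ∣           ∎
    where open ℕ.≤-Reasoning

  overcount-twice : ∀ {p q s c : Subset n} {m l} → Disjoint s c → s ⊆ p ∪ q → c ⊆ p → c ⊆ q →
    ∣ s ∣ ≡ m ℕ.* k → l ℕ.* k ℕ.≤ ∣ c ∣ → 10 ℕ.≤ m ℕ.+ (l ℕ.+ l) → 10 ℕ.* k ℕ.≤ ∣ p ∣ ℕ.+ ∣ q ∣
  overcount-twice {p} {q} {s} {c} {m} {l} disj s⊆ c⊆p c⊆q size-s size-c 10≤ = begin
    10 ℕ.* k                        ≤⟨ ℕ.*-monoˡ-≤ k 10≤ ⟩
    (m ℕ.+ (l ℕ.+ l)) ℕ.* k         ≡⟨ trans (ℕ.*-distribʳ-+ k m (l ℕ.+ l))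
                                         (cong (m ℕ.* k ℕ.+_) (ℕ.*-distribʳ-+ k l l)) ⟩
    m ℕ.* k ℕ.+ (l ℕ.* k ℕ.+ l ℕ.* k) ≤⟨ ℕ.+-mono-≤ (ℕ.≤-reflexive (sym size-s)) (ℕ.+-mono-≤ size-c size-c) ⟩
    ∣ s ∣ ℕ.+ (∣ c ∣ ℕ.+ ∣ c ∣)     ≤⟨ double-count disj s⊆ c⊆p c⊆q ⟩
    ∣ p ∣ ℕ.+ ∣ q ∣                 ∎
    where open ℕ.≤-Reasoning

  module _ (E : Scenario algorithm f) {d : Carrier} (0<d : 0# < d) where
    open Scenario E using (target; faulty; atMost) renaming (transcript to H)

    0≤d : 0# ≤ d
    0≤d = <⇒≤ 0<d

    stays : ∀ {ρ i x s} → (∀ t → 0# ≤ t → t < s → ¬ Turn H ρ t) → duty i ≡ on ρ x →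
      at (assigned E i) s ≡ signed ρ s
    stays {x = x} {s = s} none eq = trans (cong (λ d → at (motion H d) s) eq) (motion-unturned none x)

    team-stays : ∀ {ρ i s} → (∀ t → 0# ≤ t → t < s → ¬ Turn H ρ t) → i ∈ squad ρ everyone nobody →
      at (assigned E i) s ≡ signed ρ s
    team-stays {ρ} none i∈ with squad⁻ ρ everyone _ i∈
    ... | inj₁ (_ , eq , _) = stays none eq

    lead-at : ∀ {ρ i s} → i ∈ squad ρ leads nobody → at (assigned E i) s ≡ signed ρ s
    lead-at {ρ} {s = s} i∈ with squad⁻ ρ leads _ i∈
    ... | inj₁ (lead , eq , _) = cong (λ d → at (motion H d) s) eq

    team-alarm : ∀ ρ {t} → 0# ≤ t → target ≡ signed ρ t → (∀ s → 0# ≤ s → s < t → ¬ Turn H ρ s) →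
      Alarm H ρ t × Found E t
    team-alarm ρ {t} 0≤t target≡ none = Quorum-honest E (2 ℕ.* k) ρ everyone _ 0≤t target≡
      (λ i∈ s 0≤s s≤t → team-stays (λ r 0≤r r<s → none r 0≤r (<-≤-trans r<s s≤t)) i∈)
      enough 0<2k
      where
      S = squad ρ everyone nobody
      enough : 2 ℕ.* k ℕ.+ ∣ S ∩ faulty ∣ ℕ.≤ ∣ S ∣
      enough = begin
        2 ℕ.* k ℕ.+ ∣ S ∩ faulty ∣  ≤⟨ ℕ.+-monoʳ-≤ (2 ℕ.* k) (ℕ.≤-trans (∣p∩q∣≤∣q∣ S faulty) (ℕ.≤-trans atMost (ℕ.<⇒≤ f<5k))) ⟩
        2 ℕ.* k ℕ.+ 5 ℕ.* k         ≡⟨ sym (ℕ.*-distribʳ-+ k 2 5) ⟩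
        7 ℕ.* k                     ≡⟨ sym (∣squad∣ ρ everyone nobody) ⟩
        ∣ S ∣                       ∎
        where open ℕ.≤-Reasoning

    AnyAlarm : Carrier → Set
    AnyAlarm t = ∃[ σ ] Alarm H σ t

    -- Without an alarm before time `d` nobody on the target's side has turned, so the reliable part
    -- of that team raises one at `d`. The adversary can only make an alarm come earlier.
    alarm-by : ∀ ξ → target ≡ signed ξ d → ∃[ t ] t ≤ d × 0# ≤ t × AnyAlarm t
    alarm-by ξ target≡ with decide (∃[ t ] t ≤ d × 0# ≤ t × AnyAlarm t)
    ... | yes alarm = alarm
    ... | no  none  = d , ≤-refl , 0≤d , ξ , proj₁ (team-alarm ξ 0≤d target≡
      λ t 0≤t t<d turn → none (t , <⇒≤ t<d , 0≤t , _ , Turn⇒Alarm turn))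

    first-turn : ∀ {ξ} → target ≡ signed ξ d → ∃[ ρ ] ∃[ t ] t ≤ d × Earliest (Turn H ρ) t
    first-turn {ξ} target≡ =
      let t , t≤d , 0≤t , alarm = alarm-by ξ target≡
          s , s≤t , earliest    = Earliest-Quorum {H = H} (λ (σ , q) → Quorum⇒FirstCall {ρ = σ} {H = H} 0<2k q) 0≤t alarm
          ρ , turn              = turn-at earliest
      in ρ , s , ≤-trans s≤t t≤d , turn
      where
      turn-at : ∀ {t} → Earliest AnyAlarm t → ∃[ ρ ] Earliest (Turn H ρ) t
      turn-at {t} (0≤t , (σ , alarm) , least) with decide (Alarm H right t)
      -- Asking about the right side first matches the tie-break: with alarms on both sides at `t`,
      -- the left team turns.
      ... | yes alarmʳ = left , 0≤t ,
        (alarmʳ , λ s 0≤s s<t alarmˡ → <⇒≱ s<t (least s 0≤s (left , alarmˡ))) ,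
        λ s 0≤s turn → least s 0≤s (right , proj₁ turn)
      turn-at {t} (0≤t , (right , alarm) , least) | no  none = contradiction alarm none
      turn-at {t} (0≤t , (left , alarm) , least) | no  none = right , 0≤t ,
        (alarm , λ s 0≤s s≤t alarmʳ → none (subst (Alarm H right)
          (antisym s≤t (least s 0≤s (right , alarmʳ))) alarmʳ)) ,
        λ s 0≤s turn → least s 0≤s (left , proj₁ turn)

    T : Carrier
    T = fromℕ 3 * d

    -- Both delays of late visitors, t + t and (u - t) + (u - t), have this shape.
    scale : ∀ {x y} → x ≤ d → y ≤ d → d + (x + y) ≤ T
    scale {x} {y} x≤d y≤d = shift-≤₂ x≤d y≤d (solve 3
      (λ d x y → con (ℤ.+ 3) :* d :- (d :+ (x :+ y)) := (d :- x) :+ (d :- y)) refl d x y)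

    d≤T : d ≤ T
    d≤T = shift-≤₂ 0≤d 0≤d (solve 1
      (λ d → con (ℤ.+ 3) :* d :- d := (d :- con (ℤ.+ 0)) :+ (d :- con (ℤ.+ 0))) refl d)

    Found-by-T : Found E d → Found E T
    Found-by-T (i , i∉F , s , 0≤s , s≤d , told) = i , i∉F , s , 0≤s , ≤-trans s≤d d≤T , told

    Overcount : Set
    Overcount = ∀ (E′ : Scenario algorithm f) → AgreeUpTo T H (Scenario.transcript E′) →
      Scenario.target E′ ≢ target → 10 ℕ.* k ℕ.≤ ∣ faulty ∣ ℕ.+ ∣ Scenario.faulty E′ ∣

    Overcount⇒Certain : Overcount → Certain E T
    Overcount⇒Certain over E′ agree with decide (Scenario.target E′ ≡ target)
    ... | yes same = same
    ... | no  diff = contradiction (over E′ agree diff) (not-10k atMost (Scenario.atMost E′))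

    module _ {ρ t} (turn : Earliest (Turn H ρ) t) (t≤d : t ≤ d) where

      0≤t : 0# ≤ t
      0≤t = proj₁ turn

      opposite-unturned : ∀ s → 0# ≤ s → ¬ Turn H (opposite ρ) s
      opposite-unturned s 0≤s = Turn-exclusive 0≤t 0≤s (proj₁ (proj₂ turn))

      opposite-at : ∀ {i x s} → duty i ≡ on (opposite ρ) x → at (assigned E i) s ≡ signed (opposite ρ) s
      opposite-at = stays (λ s 0≤s _ → opposite-unturned s 0≤s)

      duty-at : ∀ {i s δ z} → duty i ≡ δ → at (motion H δ) s ≡ z → at (assigned E i) s ≡ z
      duty-at {s = s} eq = trans (cong (λ δ → at (motion H δ) s) eq)

      apart : ∀ {i x y} → duty i ≡ on ρ x → duty i ≢ on (opposite ρ) y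
      apart eq eq′ = case trans (sym eq) eq′ of λ same → opposite-≢ ρ (cong side same)
        where
        side : Duty → Side
        side idle     = ρ
        side (on σ _) = σ

      -- The alarm came from the target's side. It may still be false, raised at a smaller distance,
      -- but it sends the voters the right way, and the 7k robots of that side all pass the target
      -- at time `d`.
      overcount-same : target ≡ signed (opposite ρ) d → Overcount
      overcount-same target≡ E′ agree diff with decide (∃[ u ] 0# ≤ u × u < d + (t + t) × Return H ρ u)
      -- With no call back before the crossing ends, k follows and 2k returns join the 7k visitors.
      ... | no  no-return = overcount-≤ S⊆ (∣squad∣ ρ nonleads everyone) ℕ.≤-refl
        where
        crossing : 0# ≤ d + (t + t)
        crossing = +-nonNeg 0≤d (+-nonNeg 0≤t 0≤t)
        by-crossing : ∀ {i x} → duty i ≡ on ρ x → at (motion H (on ρ x)) (d + (t + t)) ≡ signed (opposite ρ) d →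
          i ∈ faulty ∪ Scenario.faulty E′
        by-crossing eq there = caught E E′ agree diff crossing (scale t≤d t≤d)
          (inj₁ (duty-at eq (trans there (sym target≡))))
        S⊆ : squad ρ nonleads everyone ⊆ faulty ∪ Scenario.faulty E′
        S⊆ i∈ with squad⁻ ρ nonleads everyone i∈
        ... | inj₁ (follow , eq , _) = by-crossing eq (motion-crossing turn 0≤d)
        ... | inj₁ (return , eq , _) = by-crossing eq (trans
          (at-reverseWhen-none (λ u u<s (0≤u , ret , _) → no-return (u , 0≤u , u<s , ret)))
          (motion-crossing turn 0≤d))
        ... | inj₂ (_ , eq , _) = caught E E′ agree diff 0≤d d≤T (inj₁ (trans (opposite-at eq) (sym target≡)))
      ... | yes (u , 0≤u , u<s , (_ , D , D⊆ , k≤ , calls)) with decide (Scenario.target E′ ≡ signed ρ u)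
      -- The call back names the rival target, which all 4k leads passed at time `u`: 4k + 7k.
      ...   | yes target′≡ = overcount-≤ S⊆ (∣squad∣ ρ leads everyone) (ℕ.m≤m+n 10 1)
        where
        S⊆ : squad ρ leads everyone ⊆ faulty ∪ Scenario.faulty E′
        S⊆ i∈ with squad⁻ ρ leads everyone i∈
        ... | inj₁ (lead , eq , _) = caught E E′ agree diff 0≤u (≤-trans (<⇒≤ u<s) (scale t≤d t≤d))
          (inj₂ (duty-at eq (sym target′≡)))
        ... | inj₂ (_ , eq , _) = caught E E′ agree diff 0≤d d≤T (inj₁ (trans (opposite-at eq) (sym target≡)))
      -- The returns may have been diverted, but the follows still cross: k + 7k visitors, and the k
      -- callers lie under both hypotheses.
      ...   | no  target′≢ = overcount-twice {m = 8} {l = 1} disjoint S⊆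
        (λ i∈ → liar E 0≤u (proj₁ (calls i∈)) u-elsewhere)
        (λ i∈ → liar′ E E′ agree diff 0≤u (≤-trans (<⇒≤ u<s) (scale t≤d t≤d)) (proj₁ (calls i∈)) (target′≢ ∘ sym))
        (∣squad∣ ρ follows everyone) (ℕ.≤-trans (ℕ.≤-reflexive (ℕ.*-identityˡ k)) k≤) ℕ.≤-refl
        where
        u-elsewhere : signed ρ u ≢ target
        u-elsewhere eq = signed-≢ˡ ρ 0<d 0≤u (trans eq target≡)
        disjoint : Disjoint (squad ρ follows everyone) D
        disjoint i∈S i∈D with squad⁻ ρ follows everyone i∈S | squad⁻ ρ leads nobody (D⊆ i∈D)
        ... | inj₁ (follow , eq , _) | inj₁ (lead , eq′ , _) = case trans (sym eq) eq′ of λ ()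
        ... | inj₂ (_ , eq , _)      | inj₁ (_ , eq′ , _) = apart eq′ eq
        S⊆ : squad ρ follows everyone ⊆ faulty ∪ Scenario.faulty E′
        S⊆ i∈ with squad⁻ ρ follows everyone i∈
        ... | inj₁ (follow , eq , _) = caught E E′ agree diff (+-nonNeg 0≤d (+-nonNeg 0≤t 0≤t)) (scale t≤d t≤d)
          (inj₁ (duty-at eq (trans (motion-crossing turn 0≤d) (sym target≡))))
        ... | inj₂ (_ , eq , _) = caught E E′ agree diff 0≤d d≤T (inj₁ (trans (opposite-at eq) (sym target≡)))

      -- The 2k robots that gave the false alarm leave fewer than 3k faulty ones among
      -- the 4k leads.
      return-by : target ≡ signed ρ d → (∃[ u ] u ≤ d × Earliest (Return H ρ) u) × Found E d
      return-by target≡ =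
        let quorum , found = Quorum-honest E k ρ leads _ 0≤d target≡
              (λ i∈ s _ _ → lead-at i∈) enough 0<k
        in Earliest-Quorum {H = H} (λ (_ , q) → Quorum⇒FirstCall {ρ = ρ} {H = H} 0<k q) 0≤d
             ((t , 0≤t , t≤d , proj₁ (proj₂ turn)) , quorum) , found
        where
        L = squad ρ leads nobody
        alarm = Turn⇒Alarm {ρ} {H} (proj₁ (proj₂ turn))
        D = proj₁ alarm
        D⊆faulty : D ⊆ faulty
        D⊆faulty i∈ = liar E 0≤t (proj₁ (proj₂ (proj₂ (proj₂ alarm)) i∈))
          (λ eq → signed-≢ʳ ρ 0<d 0≤t (trans (sym target≡) (sym eq)))
        disjoint : Disjoint D (L ∩ faulty)
        disjoint i∈D i∈L with squad⁻ (opposite ρ) everyone nobody (proj₁ (proj₂ alarm) i∈D)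
                            | squad⁻ ρ leads nobody (p∩q⊆p L faulty i∈L)
        ... | inj₁ (_ , eq , _) | inj₁ (_ , eq′ , _) = apart eq′ eq
        enough : k ℕ.+ ∣ L ∩ faulty ∣ ℕ.≤ ∣ L ∣
        enough = ℕ.+-cancelˡ-≤ k _ _ (begin
          k ℕ.+ (k ℕ.+ ∣ L ∩ faulty ∣)      ≡⟨ sym (ℕ.+-assoc k k _) ⟩
          k ℕ.+ k ℕ.+ ∣ L ∩ faulty ∣        ≡⟨ cong (λ j → k ℕ.+ j ℕ.+ ∣ L ∩ faulty ∣) (sym (ℕ.+-identityʳ k)) ⟩
          2 ℕ.* k ℕ.+ ∣ L ∩ faulty ∣        ≤⟨ ℕ.+-monoˡ-≤ ∣ L ∩ faulty ∣ (proj₁ (proj₂ (proj₂ alarm))) ⟩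
          ∣ D ∣ ℕ.+ ∣ L ∩ faulty ∣          ≤⟨ Disjoint⇒∣p∣+∣q∣≤ disjoint D⊆faulty (p∩q⊆q L faulty) ⟩
          ∣ faulty ∣                        ≤⟨ atMost ⟩
          f                                 ≤⟨ ℕ.<⇒≤ f<5k ⟩
          k ℕ.+ 4 ℕ.* k                     ≡⟨ cong (k ℕ.+_) (sym (∣squad∣ ρ leads nobody)) ⟩
          k ℕ.+ ∣ L ∣                       ∎)
          where open ℕ.≤-Reasoning

      -- Here the alarm is false, because it came from the side without the target. Either its place
      -- is the rival target, or its authors are faulty in both scenarios.
      overcount-opposite : target ≡ signed ρ d → Overcount
      overcount-opposite target≡ E′ agree diff with decide (Scenario.target E′ ≡ signed (opposite ρ) t)
      -- The 7k robots of the alarm side passed the rival target at time `t`, and the 4k leads pass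
      -- the true one at time `d`.
      ... | yes target′≡ = overcount-≤ S⊆ (∣squad∣ ρ leads everyone) (ℕ.m≤m+n 10 1)
        where
        S⊆ : squad ρ leads everyone ⊆ faulty ∪ Scenario.faulty E′
        S⊆ i∈ with squad⁻ ρ leads everyone i∈
        ... | inj₁ (lead , eq , _) = caught E E′ agree diff 0≤d d≤T (inj₁ (duty-at eq (sym target≡)))
        ... | inj₂ (_ , eq , _) = caught E E′ agree diff 0≤t (≤-trans t≤d d≤T)
          (inj₂ (trans (opposite-at eq) (sym target′≡)))
      -- The follows have left for good; 4k leads and 2k returns visit the target, and the 2k
      -- authors of the alarm count twice.
      ... | no  target′≢ = overcount-twice {m = 6} {l = 2} disjoint S⊆
        (λ i∈ → liar E 0≤t (proj₁ (proj₂ (proj₂ (proj₂ alarm)) i∈))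
          (λ eq → signed-≢ʳ ρ 0<d 0≤t (trans (sym target≡) (sym eq))))
        (λ i∈ → liar′ E E′ agree diff 0≤t (≤-trans t≤d d≤T) (proj₁ (proj₂ (proj₂ (proj₂ alarm)) i∈)) (target′≢ ∘ sym))
        (∣squad∣ ρ outer nobody) (proj₁ (proj₂ (proj₂ alarm))) ℕ.≤-refl
        where
        alarm = Turn⇒Alarm {ρ} {H} (proj₁ (proj₂ turn))
        D = proj₁ alarm
        disjoint : Disjoint (squad ρ outer nobody) D
        disjoint i∈S i∈D with squad⁻ ρ outer nobody i∈S
                            | squad⁻ (opposite ρ) everyone nobody (proj₁ (proj₂ alarm) i∈D)
        ... | inj₁ (_ , eq , _) | inj₁ (_ , eq′ , _) = apart eq eq′
        S⊆ : squad ρ outer nobody ⊆ faulty ∪ Scenario.faulty E′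
        S⊆ i∈ with squad⁻ ρ outer nobody i∈
        ... | inj₁ (lead , eq , _) = caught E E′ agree diff 0≤d d≤T (inj₁ (duty-at eq (sym target≡)))
        ... | inj₁ (return , eq , _) =
          let u , u≤d , ret@(0≤u , ((s , 0≤s , s≤u , turn-s) , _) , _) = proj₁ (return-by target≡)
              t≤u = ≤-trans (proj₂ (proj₂ turn) s 0≤s turn-s) s≤u
              0≤u-t = ≤⇒0≤- t≤u
              u-t≤d = shift-≤₂ u≤d 0≤t (solve 3 (λ u t d → d :- (u :- t) := (d :- u) :+ (t :- con (ℤ.+ 0))) refl u t d)
          in caught E E′ agree diff (+-nonNeg 0≤d (+-nonNeg 0≤u-t 0≤u-t)) (scale u-t≤d u-t≤d)
            (inj₁ (duty-at eq (trans (motion-returning turn ret u≤d) (sym target≡))))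

    completed : ∀ {ξ} → target ≡ signed ξ d → CompletedAt E T
    completed {ξ} target≡ = by-side (first-turn {ξ} target≡)
      where
      by-side : ∃[ ρ ] ∃[ t ] t ≤ d × Earliest (Turn H ρ) t → CompletedAt E T
      by-side (ρ , t , t≤d , turn) with same-or-opposite ξ ρ
      ... | inj₁ refl =
        Found-by-T (proj₂ (team-alarm ξ 0≤d target≡ λ s 0≤s _ → opposite-unturned turn t≤d s 0≤s)) ,
        Overcount⇒Certain (overcount-same turn t≤d target≡)
      ... | inj₂ refl =
        Found-by-T (proj₂ (return-by turn t≤d target≡)) ,
        Overcount⇒Certain (overcount-opposite turn t≤d target≡)

  searchRatio≤3 : SearchRatio≤ n f (fromℕ 3)
  searchRatio≤3 = algorithm , λ d 0<d E side →
    T E 0<d , ≤-trans (<⇒≤ 0<d) (d≤T E 0<d) , ≤-refl ,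
    [ completed E 0<d {right} , completed E 0<d {left} ]′ side

corollary2 : ExcludedMiddle 0ℓ → (ℝ : CompleteOrderedField) →
    let open CompleteOrderedField ℝ
        open Search ℝ
    in (β : Carrier) → 0# < β → β ≤ fromℕ 5 / fromℕ 14 → Ŝ[ β ]≤ fromℕ 3
corollary2 em ℝ β 0<β β≤5/14 = fromℕ 3 , (fromℕ 14 , witness) , ≤-refl
  where
  open Motion em ℝ
  open Ceiling em ℝ
  -- f / 5 + 1 is the least k with f < 5k. The ceiling prescribes `n` exactly, so the `r` robots
  -- beyond 14k stay idle at the origin.
  team : ∀ f {n} → 14 ℕ.* suc (f ℕ./ 5) ℕ.≤ n → SearchRatio≤ n f (fromℕ 3)
  team f 14k≤n with ℕ.m≤n⇒∃[o]m+o≡n 14k≤n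
  ... | r , refl = Search≤3.searchRatio≤3 em ℝ (suc (f ℕ./ 5)) r f
    (subst₂ ℕ._<_ (sym (ℕ.m≡m%n+[m/n]*n f 5)) (ℕ.*-comm (suc (f ℕ./ 5)) 5)
      (ℕ.+-monoˡ-< (f ℕ./ 5 ℕ.* 5) (ℕ.m%n<n f 5)))
  witness : ∀ f → 0 ℕ.< f → ∃[ n ] IsCeiling (fromℕ f / β + fromℕ 14) n × SearchRatio≤ n f (fromℕ 3)
  witness f _ =
    let n , isCeiling = ceiling (+-nonNeg (*-nonNeg (fromℕ-nonNeg f) (⁻¹-nonNeg 0<β)) (fromℕ-nonNeg 14))
    in n , isCeiling , team f (robots-needed f 0<β β≤5/14 (proj₁ isCeiling))
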